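{- For all integers $n\ge 0$ and all integers $k\ge j\ge 0$, \[ a_{9(k-j)+5,\;9k+1}(9n+6)\equiv 0 \pmod 3. \]
   Context: For positive integers $r,s$, $a_{r,s}(n)$ denotes the number of multicolored partitions of $n$ in which each even part may appear in one of $r$ colors and each odd part may appear in one of $s$ colors (copies of the same part size in different colors are distinct), with $a_{r,s}(0)=1$. Equivalently, for $|q|<1$, $\sum_{n\ge0}a_{r,s}(n)q^n = f_2^{s-r}/f_1^{s}$, where $f_m=\prod_{i\ge1}(1-q^{mi})$. -}

module Defs where

open import Data.Nat using (ℕ; zero; suc; _+_; _*_; _∸_; _≤ᵇ_; _≡ᵇ_)
open import Data.Nat.Properties using ()
open import Data.Bool using (Bool; true; false; if_then_else_)
open import Data.List using (List; []; _∷_; _++_; replicate)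

even? : ℕ → Bool
even? zero = true
even? (suc zero) = false
even? (suc (suc m)) = even? m

-- A "kind" of part is a (part size, colour) pair; we list the part sizes of all
-- kinds, one entry per colour.  Part size m occurs r times if m is even and
-- s times if m is odd (m = 1 .. N).
kinds : ℕ → ℕ → ℕ → List ℕ
kinds r s zero = []
kinds r s (suc m) =
  replicate (if even? (suc m) then r else s) (suc m) ++ kinds r s m

mutual
  ways : List ℕ → ℕ → ℕ
  ways [] zero = 1
  ways [] (suc _) = 0
  ways (d ∷ ds) n = sumMult d ds n n

  sumMult : ℕ → List ℕ → ℕ → ℕ → ℕ
  sumMult d ds n zero = ways ds n
  sumMult d ds n (suc b) =
    (if (suc b * d) ≤ᵇ n then ways ds (n ∸ suc b * d) else 0) + sumMult d ds n b

-- a_{r,s}(n): number of partitions of n where each even part may appear in one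
-- of r colours and each odd part in one of s colours. Only parts of size ≤ n
-- can occur, so kinds r s n lists all relevant coloured parts. a_{r,s}(0) = 1.
a : ℕ → ℕ → ℕ → ℕ
a r s n = ways (kinds r s n) n

{-# OPTIONS --safe #-}

-- Put W = Σ a_{r,s}(n) qⁿ = f₂^(s−r) / f₁^s with r = 9a + 5, s = 9b + 1.  Modulo 3
-- the ninth powers f₁⁹ and f₂⁹ are series in q⁹ with constant term 1, so multiplying
-- by them does not affect whether all coefficients in the class 6 mod 9 vanish.  This
-- replaces W by f₂³ · (f₂² / f₁), where f₂³ ≡ f₆ is a theta series by Euler’s
-- pentagonal number theorem and f₂² / f₁ is one by Gauss’s triangular number theorem:
--   f₆ · f₂² / f₁ = Σ_{k,l ∈ ℤ} (−1)^l q^(k(2k−1) + 3l(3l−1)).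
-- With x = 4k − 1 and y = 6l − 1 the exponent n satisfies 8n + 3 = x² + 2y².  If
-- n ≡ 6 mod 9, multiplication of x + y√−2 by (1 − √−2)/(1 + √−2) or its inverse pairs
-- the representations so that the sign (−1)^l changes, and the coefficient is 0.
-- Both theta identities come from Shanks’s finite versions, which telescope in n.

module Submission where

open import Defs
open import Algebra.Bundles using (CommutativeRing)
open import Algebra.Solver.Ring.AlmostCommutativeRing using (fromCommutativeRing; _-Raw-AlmostCommutative⟶_)
import Algebra.Solver.Ring
import Algebra.Properties.AbelianGroup
import Algebra.Properties.CommutativeSemiring.Exp
import Algebra.Properties.Ring
open import Data.Bool using (if_then_else_; true; false)
open import Data.Empty using (⊥-elim)
open import Data.Integer as ℤ using (ℤ; +_; 0ℤ; 1ℤ; -[1+_]; ∣_∣)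
import Data.Integer.Properties as ℤₚ
import Data.Integer.DivMod as ℤDivMod
import Data.Integer.Divisibility.Signed as ℤ∣
open import Data.Integer.Solver using (module +-*-Solver)
open import Data.List using (List; []; _∷_; _++_; map; filter; cartesianProduct; replicate)
open import Data.List.Membership.Propositional using (_∈_)
open import Data.List.Membership.Propositional.Properties using (∈-cartesianProduct⁺; ∈-filter⁺; ∈-filter⁻; ∈-map⁺; ∈-map⁻; ∈-++⁺ˡ; ∈-++⁺ʳ; ∈-++⁻)
open import Data.List.Membership.Propositional.Properties.WithK using (unique∧set⇒bag)
open import Data.List.Properties using (filter-accept; filter-reject)
open import Data.List.Relation.Binary.BagAndSetEquality using (∼bag⇒↭)
open import Data.List.Relation.Binary.Permutation.Propositional as ↭ using (_↭_; prep; swap)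
open import Data.List.Relation.Unary.All as All using (All; []; _∷_)
import Data.List.Relation.Unary.All.Properties as Allₚ
open import Data.List.Relation.Unary.AllPairs using ([]; _∷_)
open import Data.List.Relation.Unary.Any using (here; there)
open import Data.List.Relation.Unary.Unique.Propositional using (Unique)
import Data.List.Relation.Unary.Unique.Propositional.Properties as Unique
open import Data.Maybe using (Maybe; just; nothing)
open import Data.Nat using (ℕ; zero; suc; _≤_; _<_; s≤s; z≤n; _≤ᵇ_)
import Data.Nat as ℕ
import Data.Nat.Divisibility as ℕ∣
open import Data.Nat.Induction using (<-rec)
import Data.Nat.Properties as ℕₚ
import Data.Nat.Solver as ℕSolver
open import Data.Product using (_×_; _,_; proj₁; proj₂; ∃)
open import Data.Sum using (_⊎_; inj₁; inj₂)
open import Function.Bundles using (mk⇔)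
open import Relation.Binary.PropositionalEquality as ≡ using (_≡_; _≢_; cong; cong₂; subst)
open import Relation.Nullary using (yes; no)

open Algebra.Properties.AbelianGroup ℤₚ.+-0-abelianGroup using (∙-cancelˡ)

-- Power series

-- Why 5 and 1: with A = f₂ and B = f₁/f₂ the series W is 1/(A^(9a+5) B^(9b+1)). Completing the
-- exponent of A to 9(a + 1) leaves A⁴/B = A³ · (A/B), and A/B is Gauss's product. Why 6 mod 9:
-- there 8n + 3 ≡ 6 mod 9, so 3 divides x² + 2y² exactly once. As 3 = (1 + √-2)(1 - √-2), exactly
-- one of these two primes divides x + y√-2, and it can be exchanged for its conjugate; no
-- representation is its own partner. Infinite products and quotients are avoided: all series are
-- compared modulo 3 and q^(N + 1), where N is the index of the coefficient in question. Then every
-- product is finite, q^(N + 1) is 0, and Shanks's finite identities hold in any commutative ring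
-- that contains the required inverses.

infix 4 _≡₃_
-- A record rather than the bare divisibility, so that unification can recover x and y from the
-- type.
record _≡₃_ (x y : ℤ) : Set where
  constructor mod₃
  field divides₃ : (+ 3) ℤ∣.∣ (x ℤ.- y)
open _≡₃_

≡₃-reflexive : ∀ {x y} → x ≡ y → x ≡₃ y
≡₃-reflexive {x} ≡.refl = mod₃ (ℤ∣.divides 0ℤ (ℤₚ.+-inverseʳ x))

≡₃-sym : ∀ {x y} → x ≡₃ y → y ≡₃ x
≡₃-sym {x} {y} (mod₃ p) = mod₃ (subst ((+ 3) ℤ∣.∣_) (solve 2 (λ x y → :- (x :- y) := y :- x) ≡.refl x y) (ℤ∣.∣m⇒∣-m p))
  where open +-*-Solver

≡₃-trans : ∀ {x y z} → x ≡₃ y → y ≡₃ z → x ≡₃ z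
≡₃-trans {x} {y} {z} (mod₃ p) (mod₃ r) = mod₃ (subst ((+ 3) ℤ∣.∣_)
  (solve 3 (λ x y z → (x :- y) :+ (y :- z) := x :- z) ≡.refl x y z) (ℤ∣.∣m∣n⇒∣m+n p r))
  where open +-*-Solver

+-cong₃ : ∀ {x y u v} → x ≡₃ y → u ≡₃ v → x ℤ.+ u ≡₃ y ℤ.+ v
+-cong₃ {x} {y} {u} {v} (mod₃ p) (mod₃ r) = mod₃ (subst ((+ 3) ℤ∣.∣_)
  (solve 4 (λ x y u v → (x :- y) :+ (u :- v) := (x :+ u) :- (y :+ v)) ≡.refl x y u v) (ℤ∣.∣m∣n⇒∣m+n p r))
  where open +-*-Solver

-‿cong₃ : ∀ {x y} → x ≡₃ y → ℤ.- x ≡₃ ℤ.- y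
-‿cong₃ {x} {y} (mod₃ p) = mod₃ (subst ((+ 3) ℤ∣.∣_)
  (solve 2 (λ x y → :- (x :- y) := :- x :- :- y) ≡.refl x y) (ℤ∣.∣m⇒∣-m p))
  where open +-*-Solver

*-cong₃ : ∀ {x y u v} → x ≡₃ y → u ≡₃ v → x ℤ.* u ≡₃ y ℤ.* v
*-cong₃ {x} {y} {u} {v} (mod₃ p) (mod₃ r) = mod₃ (subst ((+ 3) ℤ∣.∣_)
  (solve 4 (λ x y u v → (x :- y) :* u :+ y :* (u :- v) := (x :* u) :- (y :* v)) ≡.refl x y u v)
  (ℤ∣.∣m∣n⇒∣m+n (ℤ∣.∣m⇒∣m*n u p) (ℤ∣.∣n⇒∣m*n y r)))
  where open +-*-Solver

Series : Set
Series = ℕ → ℤ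

infixl 6 _⊕_
infixl 7 _⊛_ _•_

_⊕_ : Series → Series → Series
(f ⊕ g) n = f n ℤ.+ g n

⊖_ : Series → Series
(⊖ f) n = ℤ.- f n

_•_ : ℤ → Series → Series
(c • f) n = c ℤ.* f n

tail : Series → Series
tail f n = f (suc n)

-- The Cauchy product, split along f = f 0 + q · `tail f`, so that its laws follow by induction on
-- the exponent with the series left general.
_⊛_ : Series → Series → Series
(f ⊛ g) zero    = f 0 ℤ.* g 0
(f ⊛ g) (suc n) = f 0 ℤ.* g (suc n) ℤ.+ (tail f ⊛ g) n

constant : ℤ → Series
constant c zero    = c
constant c (suc n) = 0ℤ

𝟘 : Series
𝟘 n = 0ℤ

X : ℕ → Series
X zero    = constant 1ℤ
X (suc d) zero    = 0ℤ
X (suc d) (suc n) = X d n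

⊛-distribʳ : ∀ h f g n → ((f ⊕ g) ⊛ h) n ≡ ((f ⊛ h) ⊕ (g ⊛ h)) n
⊛-distribʳ h f g zero = ℤₚ.*-distribʳ-+ (h 0) (f 0) (g 0)
⊛-distribʳ h f g (suc n) = ≡.trans (cong (λ z → (f 0 ℤ.+ g 0) ℤ.* h (suc n) ℤ.+ z) (⊛-distribʳ h (tail f) (tail g) n))
  (solve 5 (λ a b c d e → (a :+ b) :* c :+ (d :+ e) := (a :* c :+ d) :+ (b :* c :+ e)) ≡.refl
    (f 0) (g 0) (h (suc n)) ((tail f ⊛ h) n) ((tail g ⊛ h) n))
  where open +-*-Solver

•-⊛ : ∀ c f g n → ((c • f) ⊛ g) n ≡ c ℤ.* (f ⊛ g) n
•-⊛ c f g zero = ℤₚ.*-assoc c (f 0) (g 0)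
•-⊛ c f g (suc n) = ≡.trans (cong (λ z → (c ℤ.* f 0) ℤ.* g (suc n) ℤ.+ z) (•-⊛ c (tail f) g n))
  (solve 4 (λ c a b d → (c :* a) :* b :+ c :* d := c :* (a :* b :+ d)) ≡.refl c (f 0) (g (suc n)) ((tail f ⊛ g) n))
  where open +-*-Solver

⊛-assoc : ∀ f g h n → ((f ⊛ g) ⊛ h) n ≡ (f ⊛ (g ⊛ h)) n
⊛-assoc f g h zero = ℤₚ.*-assoc (f 0) (g 0) (h 0)
⊛-assoc f g h (suc n) = begin
  (f 0 ℤ.* g 0) ℤ.* h (suc n) ℤ.+ (((f 0 • tail g) ⊕ (tail f ⊛ g)) ⊛ h) n
    ≡⟨ cong (λ z → (f 0 ℤ.* g 0) ℤ.* h (suc n) ℤ.+ z) (⊛-distribʳ h (f 0 • tail g) (tail f ⊛ g) n) ⟩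
  (f 0 ℤ.* g 0) ℤ.* h (suc n) ℤ.+ (((f 0 • tail g) ⊛ h) n ℤ.+ ((tail f ⊛ g) ⊛ h) n)
    ≡⟨ cong₂ (λ y z → (f 0 ℤ.* g 0) ℤ.* h (suc n) ℤ.+ (y ℤ.+ z)) (•-⊛ (f 0) (tail g) h n) (⊛-assoc (tail f) g h n) ⟩
  (f 0 ℤ.* g 0) ℤ.* h (suc n) ℤ.+ (f 0 ℤ.* (tail g ⊛ h) n ℤ.+ (tail f ⊛ (g ⊛ h)) n)
    ≡⟨ solve 5 (λ a b c d e → (a :* b) :* c :+ (a :* d :+ e) := a :* (b :* c :+ d) :+ e) ≡.refl
         (f 0) (g 0) (h (suc n)) ((tail g ⊛ h) n) ((tail f ⊛ (g ⊛ h)) n) ⟩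
  f 0 ℤ.* (g 0 ℤ.* h (suc n) ℤ.+ (tail g ⊛ h) n) ℤ.+ (tail f ⊛ (g ⊛ h)) n ∎
  where open +-*-Solver
        open ≡.≡-Reasoning

-- The mirror image of the defining recursion, which splits the left factor; commutativity plays one
-- against the other.
⊛-sucʳ : ∀ f g n → (f ⊛ g) (suc n) ≡ f (suc n) ℤ.* g 0 ℤ.+ (f ⊛ tail g) n
⊛-sucʳ f g zero = ℤₚ.+-comm (f 0 ℤ.* g 1) (f 1 ℤ.* g 0)
⊛-sucʳ f g (suc n) = ≡.trans (cong (λ z → f 0 ℤ.* g (suc (suc n)) ℤ.+ z) (⊛-sucʳ (tail f) g n))
  (solve 3 (λ a b c → a :+ (b :+ c) := b :+ (a :+ c)) ≡.refl
    (f 0 ℤ.* g (suc (suc n))) (f (suc (suc n)) ℤ.* g 0) ((tail f ⊛ tail g) n))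
  where open +-*-Solver

⊛-comm : ∀ f g n → (f ⊛ g) n ≡ (g ⊛ f) n
⊛-comm f g zero = ℤₚ.*-comm (f 0) (g 0)
⊛-comm f g (suc n) = ≡.trans
  (cong₂ ℤ._+_ (ℤₚ.*-comm (f 0) (g (suc n))) (⊛-comm (tail f) g n)) (≡.sym (⊛-sucʳ g f n))

𝟘-⊛ : ∀ f n → (𝟘 ⊛ f) n ≡ 0ℤ
𝟘-⊛ f zero    = ≡.refl
𝟘-⊛ f (suc n) = ≡.trans (ℤₚ.+-identityˡ _) (𝟘-⊛ f n)

constant-⊛ : ∀ c f n → (constant c ⊛ f) n ≡ c ℤ.* f n
constant-⊛ c f zero    = ≡.refl
constant-⊛ c f (suc n) = ≡.trans (cong (λ z → c ℤ.* f (suc n) ℤ.+ z) (𝟘-⊛ f n)) (ℤₚ.+-identityʳ _)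

⊛-identityˡ : ∀ f n → (constant 1ℤ ⊛ f) n ≡ f n
⊛-identityˡ f n = ≡.trans (constant-⊛ 1ℤ f n) (ℤₚ.*-identityˡ (f n))

X-⊛-≥ : ∀ d f n → (X d ⊛ f) (d ℕ.+ n) ≡ f n
X-⊛-≥ zero    f n = ⊛-identityˡ f n
X-⊛-≥ (suc d) f n = ≡.trans (ℤₚ.+-identityˡ _) (X-⊛-≥ d f n)

X-⊛-< : ∀ d f n → n < d → (X d ⊛ f) n ≡ 0ℤ
X-⊛-< (suc d) f zero    n<d       = ≡.refl
X-⊛-< (suc d) f (suc n) (s≤s n<d) = ≡.trans (ℤₚ.+-identityˡ _) (X-⊛-< d f n n<d)

X-diagonal : ∀ d → X d d ≡ 1ℤ
X-diagonal zero    = ≡.refl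
X-diagonal (suc d) = X-diagonal d

X-off-diagonal : ∀ d n → d ≡.≢ n → X d n ≡ 0ℤ
X-off-diagonal zero    zero    d≢n = ⊥-elim (d≢n ≡.refl)
X-off-diagonal zero    (suc n) d≢n = ≡.refl
X-off-diagonal (suc d) zero    d≢n = ≡.refl
X-off-diagonal (suc d) (suc n) d≢n = X-off-diagonal d n (λ e → d≢n (cong suc e))

X-+ : ∀ c d n → (X c ⊛ X d) n ≡ X (c ℕ.+ d) n
X-+ zero    d n       = ⊛-identityˡ (X d) n
X-+ (suc c) d zero    = ≡.refl
X-+ (suc c) d (suc n) = ≡.trans (ℤₚ.+-identityˡ _) (X-+ c d n)

-- Coefficient n of a product involves only coefficients up to n. Hence agreement up to q^N is a
-- congruence.
⊛-cong₃ : ∀ {f g h k} n → (∀ m → m ≤ n → f m ≡₃ g m) → (∀ m → m ≤ n → h m ≡₃ k m) →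
          (f ⊛ h) n ≡₃ (g ⊛ k) n
⊛-cong₃ zero    p r = *-cong₃ (p 0 z≤n) (r 0 z≤n)
⊛-cong₃ (suc n) p r = +-cong₃ (*-cong₃ (p 0 z≤n) (r (suc n) ℕₚ.≤-refl))
  (⊛-cong₃ n (λ m m≤n → p (suc m) (s≤s m≤n)) (λ m m≤n → r m (ℕₚ.m≤n⇒m≤1+n m≤n)))

-- The carrier is all of ℤ[[q]], but equality is modulo 3 and q ^ (N + 1).
module Truncated (N : ℕ) where

  infix 4 _≈_
  record _≈_ (f g : Series) : Set where
    constructor mk≈
    field at : ∀ n → n ≤ N → f n ≡₃ g n
  open _≈_ public

  pointwise : ∀ {f g} → (∀ n → f n ≡ g n) → f ≈ g
  pointwise p .at n _ = ≡₃-reflexive (p n)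

  seriesRing : CommutativeRing _ _
  seriesRing = record
    { Carrier = Series ; _≈_ = _≈_ ; _+_ = _⊕_ ; _*_ = _⊛_ ; -_ = ⊖_ ; 0# = 𝟘 ; 1# = constant 1ℤ
    ; isCommutativeRing = record
      { isRing = record
        { +-isAbelianGroup = record
          { isGroup = record
            { isMonoid = record
              { isSemigroup = record
                { isMagma = record
                  { isEquivalence = record
                    { refl  = pointwise λ n → ≡.refl
                    ; sym   = λ p → mk≈ λ n n≤N → ≡₃-sym (at p n n≤N)
                    ; trans = λ p r → mk≈ λ n n≤N → ≡₃-trans (at p n n≤N) (at r n n≤N)
                    }
                  ; ∙-cong = λ p r → mk≈ λ n n≤N → +-cong₃ (at p n n≤N) (at r n n≤N)
                  }
                ; assoc = λ f g h → pointwise λ n → ℤₚ.+-assoc (f n) (g n) (h n)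
                }
              ; identity = (λ f → pointwise λ n → ℤₚ.+-identityˡ (f n))
                         , (λ f → pointwise λ n → ℤₚ.+-identityʳ (f n))
              }
            ; inverse = (λ f → pointwise λ n → ℤₚ.+-inverseˡ (f n))
                      , (λ f → pointwise λ n → ℤₚ.+-inverseʳ (f n))
            ; ⁻¹-cong = λ p → mk≈ λ n n≤N → -‿cong₃ (at p n n≤N)
            }
          ; comm = λ f g → pointwise λ n → ℤₚ.+-comm (f n) (g n)
          }
        ; *-cong = λ p r → mk≈ λ n n≤N → ⊛-cong₃ n
            (λ m m≤n → at p m (ℕₚ.≤-trans m≤n n≤N)) (λ m m≤n → at r m (ℕₚ.≤-trans m≤n n≤N))
        ; *-assoc = λ f g h → pointwise (⊛-assoc f g h)
        ; *-identity = (λ f → pointwise (⊛-identityˡ f))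
                     , (λ f → pointwise λ n → ≡.trans (⊛-comm f (constant 1ℤ) n) (⊛-identityˡ f n))
        ; distrib = (λ f g h → pointwise λ n → ≡.trans (⊛-comm f (g ⊕ h) n)
                      (≡.trans (⊛-distribʳ f g h n) (cong₂ ℤ._+_ (⊛-comm g f n) (⊛-comm h f n))))
                  , (λ h f g → pointwise (⊛-distribʳ h f g))
        }
      ; *-comm = λ f g → pointwise (⊛-comm f g)
      }
    }

-- Theta series

tri : ℕ → ℕ
tri zero    = 0
tri (suc n) = suc n ℕ.+ tri n

-- The generalised pentagonal numbers l(3l - 1)/2, written as a square plus a triangular number
-- because the telescoping below produces them in this form.
pent : ℤ → ℕ
pent (+ zero)  = 0
pent (+ suc m) = suc m ℕ.* suc m ℕ.+ tri m
pent -[1+ m ]  = suc m ℕ.* suc m ℕ.+ tri (suc m)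

-- The numbers k(2k - 1). Over all integers k they run once through the triangular numbers: index 2k
-- - 1 for k > 0 and index -2k for k ≤ 0.
hex : ℤ → ℕ
hex (+ zero)  = 0
hex (+ suc m) = suc m ℕ.* (2 ℕ.* m ℕ.+ 1)
hex -[1+ m ]  = suc m ℕ.* (2 ℕ.* suc m ℕ.+ 1)

-- Radius n + 1 adds ±(n + 1), the two indices whose theta terms make up `increment n`.
window : ℕ → List ℤ
window zero    = + 0 ∷ []
window (suc n) = + suc n ∷ -[1+ n ] ∷ window n

module Theta {c ℓ} (R : CommutativeRing c ℓ) where

  open CommutativeRing R
  open Algebra.Properties.CommutativeSemiring.Exp commutativeSemiring public
  open Algebra.Properties.Ring ring using (-‿distribˡ-*; -‿distribʳ-*; -‿involutive; -0#≈0#; -‿+-comm)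
  open import Algebra.Properties.Semiring.Mult.TCOptimised semiring using (×-homo-+; ×1-homo-*; 1+×) renaming (_×_ to _·_)
  open import Relation.Binary.Reasoning.Setoid setoid

  -- The canonical map from ℤ gives the ring solver integer constants. It is not injective in the
  -- series ring, where 3 ≈ 0, so `coefficient≟` only ever confirms equalities.
  ⟦_⟧ : ℤ → Carrier
  ⟦ + n ⟧      = n · 1#
  ⟦ -[1+ n ] ⟧ = - (suc n · 1#)

  ⟦⟧-neg : ∀ a → ⟦ ℤ.- a ⟧ ≈ - ⟦ a ⟧
  ⟦⟧-neg (+ zero)  = sym -0#≈0#
  ⟦⟧-neg (+ suc n) = refl
  ⟦⟧-neg -[1+ n ]  = sym (-‿involutive _)

  ⟦⟧-⊖ : ∀ m n → ⟦ m ℤ.⊖ n ⟧ ≈ m · 1# - n · 1#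
  ⟦⟧-⊖ m       zero    = sym (trans (+-congˡ -0#≈0#) (+-identityʳ _))
  ⟦⟧-⊖ zero    (suc n) = sym (+-identityˡ _)
  ⟦⟧-⊖ (suc m) (suc n) = begin
    ⟦ suc m ℤ.⊖ suc n ⟧                    ≡⟨ ≡.cong ⟦_⟧ (ℤₚ.[1+m]⊖[1+n]≡m⊖n m n) ⟩
    ⟦ m ℤ.⊖ n ⟧                            ≈⟨ ⟦⟧-⊖ m n ⟩
    m · 1# - n · 1#                        ≈⟨ +-congʳ (trans (+-congʳ (-‿inverseʳ 1#)) (+-identityˡ _)) ⟨
    1# - 1# + m · 1# - n · 1#              ≈⟨ +-congʳ (trans (+-congʳ (+-comm _ _)) (trans (+-assoc _ _ _) (+-comm _ _))) ⟩
    1# + m · 1# - 1# - n · 1#              ≈⟨ +-assoc _ _ _ ⟩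
    1# + m · 1# + (- 1# - n · 1#)          ≈⟨ +-congˡ (-‿+-comm _ _) ⟩
    1# + m · 1# - (1# + n · 1#)            ≈⟨ +-cong (1+× m 1#) (-‿cong (1+× n 1#)) ⟨
    suc m · 1# - suc n · 1#                ∎

  ⟦⟧-+ : ∀ a b → ⟦ a ℤ.+ b ⟧ ≈ ⟦ a ⟧ + ⟦ b ⟧
  ⟦⟧-+ (+ m)      (+ n)      = ×-homo-+ 1# m n
  ⟦⟧-+ (+ m)      -[1+ n ]   = ⟦⟧-⊖ m (suc n)
  ⟦⟧-+ -[1+ m ]   (+ n)      = trans (⟦⟧-⊖ n (suc m)) (+-comm _ _)
  ⟦⟧-+ -[1+ m ]   -[1+ n ]   = trans
    (-‿cong (trans (reflexive (≡.cong (_· 1#) (≡.cong suc (≡.sym (ℕₚ.+-suc m n))))) (×-homo-+ 1# (suc m) (suc n))))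
    (sym (-‿+-comm _ _))

  ⟦⟧-pos* : ∀ m b → ⟦ + m ℤ.* b ⟧ ≈ ⟦ + m ⟧ * ⟦ b ⟧
  ⟦⟧-pos* m (+ n) = trans (reflexive (≡.cong ⟦_⟧ (≡.sym (ℤₚ.pos-* m n)))) (×1-homo-* m n)
  ⟦⟧-pos* m -[1+ n ] = begin
    ⟦ + m ℤ.* (ℤ.- + suc n) ⟧      ≡⟨ ≡.cong ⟦_⟧ (ℤₚ.neg-distribʳ-* (+ m) (+ suc n)) ⟨
    ⟦ ℤ.- (+ m ℤ.* + suc n) ⟧      ≈⟨ ⟦⟧-neg (+ m ℤ.* + suc n) ⟩
    - ⟦ + m ℤ.* + suc n ⟧          ≈⟨ -‿cong (⟦⟧-pos* m (+ suc n)) ⟩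
    - (⟦ + m ⟧ * ⟦ + suc n ⟧)      ≈⟨ -‿distribʳ-* _ _ ⟩
    ⟦ + m ⟧ * - ⟦ + suc n ⟧        ∎

  ⟦⟧-* : ∀ a b → ⟦ a ℤ.* b ⟧ ≈ ⟦ a ⟧ * ⟦ b ⟧
  ⟦⟧-* (+ m) b = ⟦⟧-pos* m b
  ⟦⟧-* -[1+ m ] b = begin
    ⟦ (ℤ.- + suc m) ℤ.* b ⟧        ≡⟨ ≡.cong ⟦_⟧ (ℤₚ.neg-distribˡ-* (+ suc m) b) ⟨
    ⟦ ℤ.- (+ suc m ℤ.* b) ⟧        ≈⟨ ⟦⟧-neg (+ suc m ℤ.* b) ⟩
    - ⟦ + suc m ℤ.* b ⟧            ≈⟨ -‿cong (⟦⟧-pos* (suc m) b) ⟩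
    - (⟦ + suc m ⟧ * ⟦ b ⟧)        ≈⟨ -‿distribˡ-* _ _ ⟩
    - ⟦ + suc m ⟧ * ⟦ b ⟧          ∎

  fromℤ : ℤ.+-*-rawRing -Raw-AlmostCommutative⟶ fromCommutativeRing R
  fromℤ = record
    { ⟦_⟧ = ⟦_⟧ ; +-homo = ⟦⟧-+ ; *-homo = ⟦⟧-* ; -‿homo = ⟦⟧-neg ; 0-homo = refl ; 1-homo = refl }

  coefficient≟ : (a b : ℤ) → Maybe (⟦ a ⟧ ≈ ⟦ b ⟧)
  coefficient≟ a b with a ℤₚ.≟ b
  ... | yes ≡.refl = just refl
  ... | no  _      = nothing

  module Solver = Algebra.Solver.Ring ℤ.+-*-rawRing (fromCommutativeRing R) fromℤ coefficient≟

  1-‿cong : ∀ {x y} → x ≈ y → 1# - x ≈ 1# - y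
  1-‿cong x≈y = +-congˡ (-‿cong x≈y)

  ∑ : ∀ {a} {A : Set a} → (A → Carrier) → List A → Carrier
  ∑ f []       = 0#
  ∑ f (x ∷ xs) = f x + ∑ f xs

  ∑-cong : ∀ {a} {A : Set a} {f g : A → Carrier} → (∀ x → f x ≈ g x) → ∀ xs → ∑ f xs ≈ ∑ g xs
  ∑-cong f≈g []       = refl
  ∑-cong f≈g (x ∷ xs) = +-cong (f≈g x) (∑-cong f≈g xs)

  ∑-++ : ∀ {a} {A : Set a} (f : A → Carrier) xs ys → ∑ f (xs ++ ys) ≈ ∑ f xs + ∑ f ys
  ∑-++ f []       ys = sym (+-identityˡ _)
  ∑-++ f (x ∷ xs) ys = trans (+-congˡ (∑-++ f xs ys)) (sym (+-assoc _ _ _))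

  ∑-*-∑ : ∀ {a b} {A : Set a} {B : Set b} (f : A → Carrier) (g : B → Carrier) xs ys →
          ∑ f xs * ∑ g ys ≈ ∑ (λ (x , y) → f x * g y) (cartesianProduct xs ys)
  ∑-*-∑ f g []       ys = zeroˡ _
  ∑-*-∑ {A = A} {B} f g (x ∷ xs) ys = begin
    (f x + ∑ f xs) * ∑ g ys                          ≈⟨ distribʳ _ _ _ ⟩
    f x * ∑ g ys + ∑ f xs * ∑ g ys                   ≈⟨ +-cong (row ys) (∑-*-∑ f g xs ys) ⟩
    ∑ h (map (x ,_) ys) + ∑ h (cartesianProduct xs ys) ≈⟨ ∑-++ h (map (x ,_) ys) _ ⟨
    ∑ h (cartesianProduct (x ∷ xs) ys)               ∎
    where
    h : A × B → Carrier
    h (x , y) = f x * g y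
    row : ∀ ys → f x * ∑ g ys ≈ ∑ h (map (x ,_) ys)
    row []       = zeroʳ _
    row (y ∷ ys) = trans (distribˡ _ _ _) (+-congˡ (row ys))

  sign : ℕ → Carrier
  sign zero    = 1#
  sign (suc n) = - sign n

  -- ∏ᵢ aᵢ over s < i ≤ s + k.
  ∏ : (ℕ → Carrier) → ℕ → ℕ → Carrier
  ∏ a s zero    = 1#
  ∏ a s (suc k) = a (suc s) * ∏ a (suc s) k

  ∏-snoc : ∀ a s k → ∏ a s (suc k) ≈ ∏ a s k * a (s ℕ.+ suc k)
  ∏-snoc a s zero rewrite ℕₚ.+-comm s 1 = *-comm _ _
  ∏-snoc a s (suc k) = begin
    a (suc s) * ∏ a (suc s) (suc k)                       ≈⟨ *-congˡ (∏-snoc a (suc s) k) ⟩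
    a (suc s) * (∏ a (suc s) k * a (suc s ℕ.+ suc k))      ≈⟨ *-assoc _ _ _ ⟨
    a (suc s) * ∏ a (suc s) k * a (suc s ℕ.+ suc k)        ≡⟨ ≡.cong (λ i → ∏ a s (suc k) * a i) (ℕₚ.+-suc s (suc k)) ⟨
    ∏ a s (suc k) * a (s ℕ.+ suc (suc k))                  ∎

  ∏-cong : ∀ {a b} → (∀ i → a (suc i) ≈ b (suc i)) → ∀ s k → ∏ a s k ≈ ∏ b s k
  ∏-cong a≈b s zero    = refl
  ∏-cong a≈b s (suc k) = *-cong (a≈b s) (∏-cong a≈b (suc s) k)

  ∏-* : ∀ a b s k → ∏ a s k * ∏ b s k ≈ ∏ (λ i → a i * b i) s k
  ∏-* a b s zero    = *-identityˡ 1#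
  ∏-* a b s (suc k) = trans (interchange (a (suc s)) (∏ a (suc s) k) (b (suc s)) (∏ b (suc s) k)) (*-congˡ (∏-* a b (suc s) k))
    where
    open Solver
    interchange : ∀ w x y z → w * x * (y * z) ≈ w * y * (x * z)
    interchange = solve 4 (λ w x y z → w :* x :* (y :* z) := w :* y :* (x :* z)) refl

  1^ : ∀ n → 1# ^ n ≈ 1#
  1^ zero    = refl
  1^ (suc n) = trans (*-identityˡ _) (1^ n)

  ∏-^ : ∀ a s k n → ∏ a s k ^ n ≈ ∏ (λ i → a i ^ n) s k
  ∏-^ a s zero    n = 1^ n
  ∏-^ a s (suc k) n = trans (^-distrib-* _ _ n) (*-congˡ (∏-^ a (suc s) k n))

  -- Along the sum s + k stays constant: it is the upper index n of Shanks’s sums.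
  ∑from : (ℕ → ℕ → Carrier) → ℕ → ℕ → Carrier
  ∑from t s zero    = t s 0
  ∑from t s (suc k) = t s (suc k) + ∑from t (suc s) k

  ∑from-zero : ∀ t s k → (∀ i j → t (s ℕ.+ i) j ≈ 0#) → ∑from t s k ≈ 0#
  ∑from-zero t s zero    t≈0 = trans (reflexive (≡.cong (λ i → t i 0) (≡.sym (ℕₚ.+-identityʳ s)))) (t≈0 0 0)
  ∑from-zero t s (suc k) t≈0 = trans
    (+-cong (trans (reflexive (≡.cong (λ i → t i (suc k)) (≡.sym (ℕₚ.+-identityʳ s)))) (t≈0 0 (suc k)))
            (∑from-zero t (suc s) k λ i j → trans (reflexive (≡.cong (λ i → t i j) (≡.sym (ℕₚ.+-suc s i)))) (t≈0 (suc i) j)))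
    (+-identityˡ 0#)

  ^-vanishes : ∀ q {m n} → q ^ m ≈ 0# → m ≤ n → q ^ n ≈ 0#
  ^-vanishes q {m} {n} qᵐ≈0 m≤n = begin
    q ^ n                   ≈⟨ ^-congʳ q (≡.sym (ℕₚ.m+[n∸m]≡n m≤n)) ⟩
    q ^ (m ℕ.+ (n ℕ.∸ m))   ≈⟨ ^-homo-* q m _ ⟩
    q ^ m * q ^ (n ℕ.∸ m)   ≈⟨ *-congʳ qᵐ≈0 ⟩
    0# * q ^ (n ℕ.∸ m)      ≈⟨ zeroˡ _ ⟩
    0#                      ∎

  module Characteristic₃ (3≈0 : 1# + 1# + 1# ≈ 0#) where

    cube : ∀ x → (1# - x) ^ 3 ≈ 1# - x ^ 3
    cube x = begin
      (1# - x) ^ 3                               ≈⟨ solve 1 (λ x → (con 1ℤ :- x) :^ 3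
                                                      := con 1ℤ :- x :^ 3 :+ (con 1ℤ :+ con 1ℤ :+ con 1ℤ) :* (x :* x :- x)) refl x ⟩
      1# - x ^ 3 + (1# + 1# + 1#) * (x * x - x)  ≈⟨ +-congˡ (trans (*-congʳ 3≈0) (zeroˡ _)) ⟩
      1# - x ^ 3 + 0#                            ≈⟨ +-identityʳ _ ⟩
      1# - x ^ 3                                 ∎
      where open Solver

    ninth : ∀ x → (1# - x) ^ 9 ≈ 1# - x ^ 9
    ninth x = begin
      (1# - x) ^ 9          ≈⟨ ^-assocʳ (1# - x) 3 3 ⟨
      ((1# - x) ^ 3) ^ 3    ≈⟨ ^-congˡ 3 (cube x) ⟩
      (1# - x ^ 3) ^ 3      ≈⟨ cube (x ^ 3) ⟩
      1# - (x ^ 3) ^ 3      ≈⟨ 1-‿cong (^-assocʳ x 3 3) ⟩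
      1# - x ^ 9            ∎

  -- Euler's pentagonal number theorem

  module Euler (q : Carrier) where

    factor : ℕ → Carrier
    factor i = 1# - q ^ i

    -- With n = s + k, Shanks's summand (-1)^s (q)ₙ/(q)ₛ q^(sn + s(s + 1)/2), where (q)ₘ = (1 -
    -- q)...(1 - q^m); `∏ factor s k` is the quotient, free of division.
    term : ℕ → ℕ → ℕ → Carrier
    term n s k = sign s * (∏ factor s k * q ^ (s ℕ.* n ℕ.+ tri s))

    shanks : ℕ → Carrier
    shanks n = ∑from (term n) 0 n

    exponent₁ : ∀ m n → q ^ (m ℕ.* suc n ℕ.+ tri m) ≈ q ^ m * q ^ (m ℕ.* n ℕ.+ tri m)
    exponent₁ m n = trans (^-congʳ q (solve 3 (λ m n t → m :* (con 1 :+ n) :+ t := m :+ (m :* n :+ t)) ≡.refl m n (tri m)))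
      (^-homo-* q m _)
      where open ℕSolver.+-*-Solver

    exponent₂ : ∀ m n → q ^ (suc m ℕ.* n ℕ.+ tri (suc m)) ≈ q ^ n * (q ^ suc m * q ^ (m ℕ.* n ℕ.+ tri m))
    exponent₂ m n = trans (^-congʳ q (solve 3 (λ m n t → (con 1 :+ m) :* n :+ (con 1 :+ m :+ t) := n :+ ((con 1 :+ m) :+ (m :* n :+ t)))
                       ≡.refl m n (tri m)))
      (trans (^-homo-* q n _) (*-congˡ (^-homo-* q (suc m) _)))
      where open ℕSolver.+-*-Solver

    increment : ℕ → Carrier
    increment n = sign (suc n) * q ^ (suc n ℕ.* suc n ℕ.+ tri (suc n)) + sign (suc n) * q ^ (suc n ℕ.* suc n ℕ.+ tri n)

    -- The extra term on the left is minus the telescoped sum of the differences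
    -- term (suc n) s − term n s over s < m.
    telescope : ∀ n m k → n ≡ m ℕ.+ k →
      ∑from (term (suc n)) m (suc k) + sign m * ((1# - q ^ m) * (∏ factor m k * q ^ (m ℕ.* n ℕ.+ tri m)))
      ≈ ∑from (term n) m k + increment n
    -- Here m = n. The summand s = n + 1 has no partner in `shanks n` and gives the first half of
    -- `increment n`; the remainder at s = n gives the second.
    telescope n m zero n≡m+0 with ≡.trans n≡m+0 (ℕₚ.+-identityʳ m)
    ... | ≡.refl = begin
      sign n * ((1# - q ^ suc n) * 1# * q ^ (n ℕ.* suc n ℕ.+ tri n)) + sign (suc n) * (1# * q ^ (suc n ℕ.* suc n ℕ.+ tri (suc n)))
        + sign n * ((1# - q ^ n) * (1# * z))
        ≈⟨ +-congʳ (+-congʳ (*-congˡ (*-congˡ (exponent₁ n n)))) ⟩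
      sign n * ((1# - q ^ suc n) * 1# * (u * z)) + sign (suc n) * (1# * r)
        + sign n * ((1# - q ^ n) * (1# * z))
        ≈⟨ solve 5 (λ σ q u z r →
             σ :* ((con 1ℤ :- q :* u) :* con 1ℤ :* (u :* z)) :+ (:- σ) :* (con 1ℤ :* r) :+ σ :* ((con 1ℤ :- u) :* (con 1ℤ :* z))
             := σ :* (con 1ℤ :* z) :+ ((:- σ) :* r :+ (:- σ) :* (q :* u :* (u :* z)))) refl (sign n) q u z r ⟩
      sign n * (1# * z) + (sign (suc n) * r + sign (suc n) * (q ^ suc n * (u * z)))
        ≈⟨ +-congˡ (+-congˡ (*-congˡ (trans (*-congˡ (sym (exponent₁ n n)))
             (trans (sym (^-homo-* q (suc n) _)) (^-congʳ q (≡.sym (ℕₚ.+-assoc (suc n) (n ℕ.* suc n) (tri n)))))))) ⟩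
      sign n * (1# * z) + increment n ∎
      where
      open Solver
      u z r : Carrier
      u = q ^ n
      z = q ^ (n ℕ.* n ℕ.+ tri n)
      r = q ^ (suc n ℕ.* suc n ℕ.+ tri (suc n))
    telescope n m (suc k) n≡ = begin
      sign m * (∏ factor m (suc (suc k)) * q ^ (m ℕ.* suc n ℕ.+ tri m)) + S₁ + sign m * ((1# - u) * (p * z))
        ≈⟨ +-congʳ (+-congʳ (*-congˡ (*-cong (∏-snoc factor m (suc k)) (exponent₁ m n)))) ⟩
      sign m * (p * factor (m ℕ.+ suc (suc k)) * (u * z)) + S₁ + sign m * ((1# - u) * (p * z))
        ≡⟨ ≡.cong (λ i → sign m * (p * factor i * (u * z)) + S₁ + sign m * ((1# - u) * (p * z)))
             (≡.trans (ℕₚ.+-suc m (suc k)) (≡.cong suc (≡.sym n≡))) ⟩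
      sign m * (p * (1# - q * y) * (u * z)) + S₁ + sign m * ((1# - u) * (p * z))
        -- (1 - q^(n+1)) q^m + (1 - q^m) = 1 - q^(m+n+1). The 1 yields the summand of `term n`; the
        -- rest is the extra term for m + 1, because `p` has the factor 1 - q^(m+1).
        ≈⟨ solve 7 (λ σ p q u y z S → σ :* (p :* (con 1ℤ :- q :* y) :* (u :* z)) :+ S :+ σ :* ((con 1ℤ :- u) :* (p :* z))
             := σ :* (p :* z) :+ (S :+ (:- σ) :* (p :* (y :* (q :* u :* z))))) refl (sign m) p q u y z S₁ ⟩
      sign m * (p * z) + (S₁ + sign (suc m) * (p * (y * (q ^ suc m * z))))
        ≈⟨ +-congˡ (+-congˡ (*-congˡ (trans (*-assoc _ _ _) (*-congˡ (*-congˡ (sym (exponent₂ m n))))))) ⟩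
      sign m * (p * z) + (S₁ + sign (suc m) * ((1# - q ^ suc m) * (∏ factor (suc m) k * q ^ (suc m ℕ.* n ℕ.+ tri (suc m)))))
        ≈⟨ +-congˡ (telescope n (suc m) k (≡.trans n≡ (ℕₚ.+-suc m k))) ⟩
      sign m * (p * z) + (∑from (term n) (suc m) k + increment n)
        ≈⟨ +-assoc _ _ _ ⟨
      sign m * (p * z) + ∑from (term n) (suc m) k + increment n ∎
      where
      open Solver
      u y z p S₁ : Carrier
      u = q ^ m
      y = q ^ n
      z = q ^ (m ℕ.* n ℕ.+ tri m)
      p = ∏ factor m (suc k)
      S₁ = ∑from (term (suc n)) (suc m) (suc k)

    shanks-theta : ∀ n → shanks n ≈ ∑ (λ l → sign ∣ l ∣ * q ^ pent l) (window n)
    shanks-theta zero = solve 0 (con 1ℤ :* (con 1ℤ :* con 1ℤ) := con 1ℤ :* con 1ℤ :+ con 0ℤ) refl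
      where open Solver
    shanks-theta (suc n) = begin
      shanks (suc n)
        -- At m = 0 the extra term has the factor 1 - q⁰ = 0, so it may be added.
        ≈⟨ solve 2 (λ x y → x := x :+ con 1ℤ :* ((con 1ℤ :- con 1ℤ) :* y)) refl _ _ ⟩
      shanks (suc n) + sign 0 * ((1# - q ^ 0) * (∏ factor 0 n * q ^ (0 ℕ.* n ℕ.+ tri 0)))
        ≈⟨ telescope n 0 n ≡.refl ⟩
      shanks n + increment n
        ≈⟨ +-congʳ (shanks-theta n) ⟩
      ∑ (λ l → sign ∣ l ∣ * q ^ pent l) (window n) + increment n
        ≈⟨ solve 3 (λ a b c → a :+ (b :+ c) := c :+ (b :+ a)) refl _ _ _ ⟩
      ∑ (λ l → sign ∣ l ∣ * q ^ pent l) (window (suc n)) ∎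
      where open Solver

    -- For s ≥ 1 the exponent sn + s(s + 1)/2 is at least n + 1, so only the summand s = 0 survives.
    shanks-product : ∀ n → q ^ suc n ≈ 0# → shanks n ≈ ∏ factor 0 n
    shanks-product zero    q≈0 = trans (*-identityˡ _) (*-identityˡ _)
    shanks-product (suc n) q≈0 = begin
      1# * (∏ factor 0 (suc n) * 1#) + ∑from (term (suc n)) 1 n
        ≈⟨ +-congˡ (∑from-zero (term (suc n)) 1 n λ i j → trans (*-congˡ (*-congˡ (^-vanishes q q≈0 (bound i)))) (trans (*-congˡ (zeroʳ _)) (zeroʳ _))) ⟩
      1# * (∏ factor 0 (suc n) * 1#) + 0#
        ≈⟨ solve 1 (λ p → con 1ℤ :* (p :* con 1ℤ) :+ con 0ℤ := p) refl _ ⟩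
      ∏ factor 0 (suc n) ∎
      where
      open Solver
      bound : ∀ i → suc (suc n) ≤ suc i ℕ.* suc n ℕ.+ tri (suc i)
      bound i = ℕₚ.≤-trans (ℕₚ.≤-reflexive (ℕₚ.+-comm 1 (suc n)))
        (ℕₚ.+-mono-≤ (ℕₚ.m≤m+n (suc n) (i ℕ.* suc n)) (s≤s z≤n))

    pentagonal : ∀ n → q ^ suc n ≈ 0# → ∏ factor 0 n ≈ ∑ (λ l → sign ∣ l ∣ * q ^ pent l) (window n)
    pentagonal n q≈0 = trans (sym (shanks-product n q≈0)) (shanks-theta n)

  -- Gauss's triangular number theorem

  module Gauss (q : Carrier) (v : ℕ → Carrier) (v-inverse : ∀ i → (1# - q ^ (2 ℕ.* i ℕ.+ 1)) * v i ≈ 1#) where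

    -- Index 0 is a dummy, as products start at 1.
    factor : ℕ → Carrier
    factor zero    = 1#
    factor (suc i) = (1# - q ^ (2 ℕ.* suc i)) * v i

    -- With n = s + k, Shanks's summand for this theorem: the product of (1 - q^(2i))/(1 - q^(2i-1))
    -- over s < i ≤ n, times q^(s(2n + 1)).
    term : ℕ → ℕ → ℕ → Carrier
    term n s k = ∏ factor s k * q ^ (s ℕ.* (2 ℕ.* n ℕ.+ 1))

    shanks : ℕ → Carrier
    shanks n = ∑from (term n) 0 n

    increment : ℕ → Carrier
    increment n = q ^ (suc n ℕ.* (2 ℕ.* n ℕ.+ 1)) + q ^ (suc n ℕ.* (2 ℕ.* suc n ℕ.+ 1))

    ^-even : ∀ m → q ^ (2 ℕ.* m) ≈ q ^ m * q ^ m
    ^-even m = trans (^-congʳ q (≡.cong (m ℕ.+_) (ℕₚ.+-identityʳ m))) (^-homo-* q m m)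

    ^-odd : ∀ m → q ^ (2 ℕ.* m ℕ.+ 1) ≈ q ^ m * q ^ m * q
    ^-odd m = trans (^-homo-* q (2 ℕ.* m) 1) (*-cong (^-even m) (*-identityʳ q))

    ^-even-suc : ∀ m → q ^ (2 ℕ.* suc m) ≈ q ^ (2 ℕ.* m ℕ.+ 1) * q
    ^-even-suc m = trans (^-congʳ q (solve 1 (λ m → con 2 :* (con 1 :+ m) := (con 2 :* m :+ con 1) :+ con 1) ≡.refl m))
      (trans (^-homo-* q (2 ℕ.* m ℕ.+ 1) 1) (*-congˡ (*-identityʳ q)))
      where open ℕSolver.+-*-Solver

    exponent : ∀ m n → q ^ (m ℕ.* (2 ℕ.* suc n ℕ.+ 1)) ≈ q ^ m * q ^ m * q ^ (m ℕ.* (2 ℕ.* n ℕ.+ 1))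
    exponent m n = trans
      (^-congʳ q (solve 2 (λ m n → m :* (con 2 :* (con 1 :+ n) :+ con 1) := (m :+ m) :+ m :* (con 2 :* n :+ con 1)) ≡.refl m n))
      (trans (^-homo-* q (m ℕ.+ m) _) (*-congʳ (^-homo-* q m m)))
      where open ℕSolver.+-*-Solver

    -- The extra term on the left is minus the telescoped sum of the differences
    -- term (suc n) s − term n s over s < m.
    telescope : ∀ n m k → n ≡ m ℕ.+ k →
      ∑from (term (suc n)) m (suc k) + ∏ factor m k * ((1# - q ^ (2 ℕ.* m)) * (q ^ (m ℕ.* (2 ℕ.* n ℕ.+ 1)) * v n))
      ≈ ∑from (term n) m k + increment n
    telescope n m zero n≡m+0 with ≡.trans n≡m+0 (ℕₚ.+-identityʳ m)
    ... | ≡.refl = begin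
      factor (suc n) * 1# * q ^ (n ℕ.* (2 ℕ.* suc n ℕ.+ 1)) + 1# * r + 1# * ((1# - q ^ (2 ℕ.* n)) * (z * v n))
        ≈⟨ +-cong (+-congʳ (*-cong (*-congʳ (*-congʳ (1-‿cong (trans (^-even-suc n) (*-congʳ (^-odd n)))))) (exponent n n)))
                  (*-congˡ (*-congʳ (1-‿cong (^-even n)))) ⟩
      (1# - u * u * q * q) * v n * 1# * (u * u * z) + 1# * r + 1# * ((1# - u * u) * (z * v n))
        ≈⟨ solve 5 (λ u q v z r →
             (con 1ℤ :- u :* u :* q :* q) :* v :* con 1ℤ :* (u :* u :* z) :+ con 1ℤ :* r :+ con 1ℤ :* ((con 1ℤ :- u :* u) :* (z :* v))
             := ((con 1ℤ :- u :* u :* q) :* v) :* z :+ (((con 1ℤ :- u :* u :* q) :* v) :* (u :* u :* q :* z) :+ r)) refl u q (v n) z r ⟩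
      (1# - u * u * q) * v n * z + ((1# - u * u * q) * v n * (u * u * q * z) + r)
        ≈⟨ +-cong (*-congʳ unit) (+-congʳ (trans (*-congʳ unit) (*-identityˡ _))) ⟩
      1# * z + (u * u * q * z + r)
        ≈⟨ +-congˡ (+-congʳ (trans (*-congʳ (sym (^-odd n))) (sym (^-homo-* q (2 ℕ.* n ℕ.+ 1) _)))) ⟩
      1# * z + increment n ∎
      where
      open Solver
      u z r : Carrier
      u = q ^ n
      z = q ^ (n ℕ.* (2 ℕ.* n ℕ.+ 1))
      r = q ^ (suc n ℕ.* (2 ℕ.* suc n ℕ.+ 1))
      unit : (1# - u * u * q) * v n ≈ 1#
      unit = trans (*-congʳ (1-‿cong (sym (^-odd n)))) (v-inverse n)
    telescope n m (suc k) n≡ = begin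
      ∏ factor m (suc (suc k)) * q ^ (m ℕ.* (2 ℕ.* suc n ℕ.+ 1)) + S₁ + p * ((1# - q ^ (2 ℕ.* m)) * (z * v n))
        ≈⟨ +-cong (+-congʳ (*-cong (∏-snoc factor m (suc k)) (exponent m n))) (*-congˡ (*-congʳ (1-‿cong (^-even m)))) ⟩
      p * factor (m ℕ.+ suc (suc k)) * (u * u * z) + S₁ + p * ((1# - u * u) * (z * v n))
        ≡⟨ ≡.cong (λ i → p * factor i * (u * u * z) + S₁ + p * ((1# - u * u) * (z * v n)))
             (≡.trans (ℕₚ.+-suc m (suc k)) (≡.cong suc (≡.sym n≡))) ⟩
      p * factor (suc n) * (u * u * z) + S₁ + p * ((1# - u * u) * (z * v n))
        ≈⟨ +-cong (+-congʳ (*-congʳ (*-cong p≈ (*-congʳ (1-‿cong (^-even-suc n)))))) (*-congʳ p≈) ⟩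
      (1# - u * u * q * q) * v m * p′ * ((1# - w * q) * v n) * (u * u * z) + S₁
        + (1# - u * u * q * q) * v m * p′ * ((1# - u * u) * (z * v n))
        -- The new grouping puts 1 - q^(2n+1) next to `v n` in the first summand and 1 - q^(2m+1)
        -- next to `v m` in the last. These pairs cancel and leave the summand of `term n` and the
        -- extra term for m + 1.
        ≈⟨ solve 8 (λ u q a p w b z S →
             (con 1ℤ :- u :* u :* q :* q) :* a :* p :* ((con 1ℤ :- w :* q) :* b) :* (u :* u :* z) :+ S
               :+ (con 1ℤ :- u :* u :* q :* q) :* a :* p :* ((con 1ℤ :- u :* u) :* (z :* b))
             := ((con 1ℤ :- w) :* b) :* ((con 1ℤ :- u :* u :* q :* q) :* a :* p :* z)
               :+ (S :+ ((con 1ℤ :- u :* u :* q) :* a) :* (p :* ((con 1ℤ :- u :* u :* q :* q) :* (w :* z :* b)))))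
             refl u q (v m) p′ w (v n) z S₁ ⟩
      (1# - w) * v n * ((1# - u * u * q * q) * v m * p′ * z)
        + (S₁ + (1# - u * u * q) * v m * (p′ * ((1# - u * u * q * q) * (w * z * v n))))
        ≈⟨ +-cong (trans (*-congʳ (v-inverse n)) (trans (*-identityˡ _) (*-congʳ (sym p≈))))
                  (+-congˡ (trans (*-congʳ unit) (trans (*-identityˡ _) (*-congˡ (*-cong
                     (1-‿cong (sym (trans (^-even-suc m) (*-congʳ (^-odd m)))))
                     (*-congʳ (sym (^-homo-* q (2 ℕ.* n ℕ.+ 1) _)))))))) ⟩
      p * z + (S₁ + p′ * ((1# - q ^ (2 ℕ.* suc m)) * (q ^ (suc m ℕ.* (2 ℕ.* n ℕ.+ 1)) * v n)))
        ≈⟨ +-congˡ (telescope n (suc m) k (≡.trans n≡ (ℕₚ.+-suc m k))) ⟩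
      p * z + (∑from (term n) (suc m) k + increment n)
        ≈⟨ +-assoc _ _ _ ⟨
      p * z + ∑from (term n) (suc m) k + increment n ∎
      where
      open Solver
      u w z p p′ S₁ : Carrier
      u = q ^ m
      w = q ^ (2 ℕ.* n ℕ.+ 1)
      z = q ^ (m ℕ.* (2 ℕ.* n ℕ.+ 1))
      p = ∏ factor m (suc k)
      p′ = ∏ factor (suc m) k
      S₁ = ∑from (term (suc n)) (suc m) (suc k)
      p≈ : p ≈ (1# - u * u * q * q) * v m * p′
      p≈ = *-congʳ (*-congʳ (1-‿cong (trans (^-even-suc m) (*-congʳ (^-odd m)))))
      unit : (1# - u * u * q) * v m ≈ 1#
      unit = trans (*-congʳ (1-‿cong (sym (^-odd m)))) (v-inverse m)

    shanks-theta : ∀ n → shanks n ≈ ∑ (λ k → q ^ hex k) (window n)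
    shanks-theta zero = solve 0 (con 1ℤ :* con 1ℤ := con 1ℤ :+ con 0ℤ) refl
      where open Solver
    shanks-theta (suc n) = begin
      shanks (suc n)
        ≈⟨ solve 3 (λ x y z → x := x :+ y :* ((con 1ℤ :- con 1ℤ) :* z)) refl _ _ _ ⟩
      shanks (suc n) + ∏ factor 0 n * ((1# - q ^ 0) * (q ^ (0 ℕ.* (2 ℕ.* n ℕ.+ 1)) * v n))
        ≈⟨ telescope n 0 n ≡.refl ⟩
      shanks n + increment n
        ≈⟨ +-congʳ (shanks-theta n) ⟩
      ∑ (λ k → q ^ hex k) (window n) + increment n
        ≈⟨ solve 3 (λ a b c → a :+ (b :+ c) := b :+ (c :+ a)) refl _ _ _ ⟩
      ∑ (λ k → q ^ hex k) (window (suc n)) ∎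
      where open Solver

    shanks-product : ∀ n → q ^ suc n ≈ 0# → shanks n ≈ ∏ factor 0 n
    shanks-product zero    q≈0 = *-identityˡ _
    shanks-product (suc n) q≈0 = begin
      ∏ factor 0 (suc n) * 1# + ∑from (term (suc n)) 1 n
        ≈⟨ +-congˡ (∑from-zero (term (suc n)) 1 n λ i j → trans (*-congˡ (^-vanishes q q≈0 (bound i))) (zeroʳ _)) ⟩
      ∏ factor 0 (suc n) * 1# + 0#
        ≈⟨ trans (+-identityʳ _) (*-identityʳ _) ⟩
      ∏ factor 0 (suc n) ∎
      where
      bound : ∀ i → suc (suc n) ≤ suc i ℕ.* (2 ℕ.* suc n ℕ.+ 1)
      bound i = ℕₚ.≤-trans (ℕₚ.≤-reflexive (ℕₚ.+-comm 1 (suc n)))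
        (ℕₚ.≤-trans (ℕₚ.+-monoˡ-≤ 1 (ℕₚ.m≤m+n (suc n) _)) (ℕₚ.m≤m+n (2 ℕ.* suc n ℕ.+ 1) _))

    triangular : ∀ n → q ^ suc n ≈ 0# → ∏ factor 0 n ≈ ∑ (λ k → q ^ hex k) (window n)
    triangular n q≈0 = trans (sym (shanks-product n q≈0)) (shanks-theta n)

-- The form x² + 2y²

module ℤΣ = Theta ℤₚ.+-*-commutativeRing

∑-↭ : ∀ {A : Set} (f : A → ℤ) {xs ys} → xs ↭ ys → ℤΣ.∑ f xs ≡ ℤΣ.∑ f ys
∑-↭ f ↭.refl        = ≡.refl
∑-↭ f (prep x p)    = cong (λ z → f x ℤ.+ z) (∑-↭ f p)
∑-↭ f (swap x y p)  = ≡.trans (cong (λ z → f x ℤ.+ (f y ℤ.+ z)) (∑-↭ f p))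
  (solve 3 (λ a b c → a :+ (b :+ c) := b :+ (a :+ c)) ≡.refl (f x) (f y) _)
  where open +-*-Solver
∑-↭ f (↭.trans p r) = ≡.trans (∑-↭ f p) (∑-↭ f r)

∑-cancel : ∀ {A B : Set} (w : B → ℤ) (f g : A → B) → (∀ x → w (f x) ≡ ℤ.- w (g x)) →
           ∀ xs → ℤΣ.∑ w (map f xs ++ map g xs) ≡ 0ℤ
∑-cancel w f g opposite xs = ≡.trans (ℤΣ.∑-++ w (map f xs) (map g xs)) (cancel xs)
  where
  open +-*-Solver
  cancel : ∀ xs → ℤΣ.∑ w (map f xs) ℤ.+ ℤΣ.∑ w (map g xs) ≡ 0ℤ
  cancel []       = ≡.refl
  cancel (x ∷ xs) = ≡.trans (cong (λ z → z ℤ.+ ℤΣ.∑ w (map f xs) ℤ.+ ℤΣ.∑ w (map g (x ∷ xs))) (opposite x))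
    (≡.trans (solve 3 (λ a b c → (:- a :+ b) :+ (a :+ c) := b :+ c) ≡.refl (w (g x)) _ _) (cancel xs))

∑-X : ∀ {A : Set} (w : A → ℤ) (e : A → ℕ) n xs →
      ℤΣ.∑ (λ x → w x ℤ.* X (e x) n) xs ≡ ℤΣ.∑ w (filter (λ x → e x ℕₚ.≟ n) xs)
∑-X w e n []       = ≡.refl
∑-X w e n (x ∷ xs) with e x ℕₚ.≟ n
... | yes ≡.refl = ≡.trans (cong₂ ℤ._+_ (≡.trans (cong (w x ℤ.*_) (X-diagonal (e x))) (ℤₚ.*-identityʳ (w x))) (∑-X w e n xs))
                       (cong (ℤΣ.∑ w) (≡.sym (filter-accept (λ x → e x ℕₚ.≟ n) ≡.refl)))
... | no  e≢n  = ≡.trans (cong₂ ℤ._+_ (≡.trans (cong (w x ℤ.*_) (X-off-diagonal (e x) n e≢n)) (ℤₚ.*-zeroʳ (w x))) (∑-X w e n xs))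
                (≡.trans (ℤₚ.+-identityˡ _) (cong (ℤΣ.∑ w) (≡.sym (filter-reject (λ x → e x ℕₚ.≟ n) e≢n))))

∈-window⁻ : ∀ {i} n → i ∈ window n → ∣ i ∣ ≤ n
∈-window⁻ zero    (here ≡.refl)         = z≤n
∈-window⁻ (suc n) (here ≡.refl)         = ℕₚ.≤-refl
∈-window⁻ (suc n) (there (here ≡.refl)) = ℕₚ.≤-refl
∈-window⁻ (suc n) (there (there i∈))  = ℕₚ.m≤n⇒m≤1+n (∈-window⁻ n i∈)

∈-window⁺ : ∀ {i} n → ∣ i ∣ ≤ n → i ∈ window n
∈-window⁺ {+ zero} zero    i≤n = here ≡.refl
∈-window⁺ {i}      (suc n) i≤n with ℕₚ.m≤n⇒m<n∨m≡n i≤n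
∈-window⁺ {i}        (suc n) _ | inj₁ (s≤s i≤n) = there (there (∈-window⁺ n i≤n))
∈-window⁺ {+ _}      (suc n) _ | inj₂ ≡.refl      = here ≡.refl
∈-window⁺ { -[1+ _ ]} (suc n) _ | inj₂ ≡.refl     = there (here ≡.refl)

window-unique : ∀ n → Unique (window n)
window-unique zero    = All.[] ∷ []
window-unique (suc n) =
  ((λ ()) All.∷ All.tabulate (outside ≡.refl)) ∷ All.tabulate (outside ≡.refl) ∷ window-unique n
  where
  outside : ∀ {i} → ∣ i ∣ ≡ suc n → ∀ {j} → j ∈ window n → i ≢ j
  outside i≡ j∈ ≡.refl = ℕₚ.<-irrefl ≡.refl (ℕₚ.≤-trans (ℕₚ.≤-reflexive (≡.sym i≡)) (∈-window⁻ n j∈))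

parity : ℤ → ℤ
parity i = ℤΣ.sign ∣ i ∣

parity-suc : ∀ i → parity (ℤ.suc i) ≡ ℤ.- parity i
parity-suc (+ n)          = ≡.refl
parity-suc -[1+ zero ]    = ≡.refl
parity-suc -[1+ suc n ]   = ≡.sym (ℤₚ.neg-involutive _)

parity-pred : ∀ i → parity (ℤ.pred i) ≡ ℤ.- parity i
parity-pred i = ≡.trans (≡.sym (ℤₚ.neg-involutive _))
  (cong ℤ.-_ (≡.trans (≡.sym (parity-suc (ℤ.pred i))) (cong parity (ℤₚ.suc-pred i))))

parity-+ : ∀ i j → parity (i ℤ.+ j) ≡ parity i ℤ.* parity j
parity-+ i (+ zero)  = ≡.trans (cong parity (ℤₚ.+-identityʳ i)) (≡.sym (ℤₚ.*-identityʳ _))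
parity-+ i (+ suc n) = begin
  parity (i ℤ.+ + suc n)           ≡⟨ cong parity (solve 2 (λ i n → i :+ (con 1ℤ :+ n) := con 1ℤ :+ (i :+ n)) ≡.refl i (+ n)) ⟩
  parity (ℤ.suc (i ℤ.+ + n))       ≡⟨ parity-suc (i ℤ.+ + n) ⟩
  ℤ.- parity (i ℤ.+ + n)           ≡⟨ cong ℤ.-_ (parity-+ i (+ n)) ⟩
  ℤ.- (parity i ℤ.* parity (+ n))  ≡⟨ ℤₚ.neg-distribʳ-* (parity i) _ ⟩
  parity i ℤ.* parity (+ suc n)    ∎
  where open +-*-Solver
        open ≡.≡-Reasoning
parity-+ i -[1+ zero ] = ≡.trans (cong parity (ℤₚ.+-comm i -[1+ 0 ]))
  (≡.trans (parity-pred i) (solve 1 (λ a → :- a := a :* con -[1+ 0 ]) ≡.refl (parity i)))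
  where open +-*-Solver
parity-+ i -[1+ suc n ] = begin
  parity (i ℤ.+ -[1+ suc n ])           ≡⟨ cong parity (solve 2 (λ i n → i :+ (con -[1+ 0 ] :+ n) := con -[1+ 0 ] :+ (i :+ n)) ≡.refl i -[1+ n ]) ⟩
  parity (ℤ.pred (i ℤ.+ -[1+ n ]))      ≡⟨ parity-pred (i ℤ.+ -[1+ n ]) ⟩
  ℤ.- parity (i ℤ.+ -[1+ n ])           ≡⟨ cong ℤ.-_ (parity-+ i -[1+ n ]) ⟩
  ℤ.- (parity i ℤ.* parity -[1+ n ])    ≡⟨ ℤₚ.neg-distribʳ-* (parity i) _ ⟩
  parity i ℤ.* parity -[1+ suc n ]      ∎
  where open +-*-Solver
        open ≡.≡-Reasoning

parity-even : ∀ i → parity (i ℤ.+ i) ≡ 1ℤ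
parity-even i = ≡.trans (parity-+ i i) (square ∣ i ∣)
  where
  open +-*-Solver
  square : ∀ n → ℤΣ.sign n ℤ.* ℤΣ.sign n ≡ 1ℤ
  square zero    = ≡.refl
  square (suc n) = ≡.trans (solve 1 (λ a → (:- a) :* (:- a) := a :* a) ≡.refl (ℤΣ.sign n)) (square n)

tri-formula : ∀ n → + 2 ℤ.* + tri n ≡ + n ℤ.* (1ℤ ℤ.+ + n)
tri-formula zero    = ≡.refl
tri-formula (suc n) = ≡.trans
  (solve 2 (λ n t → con (+ 2) :* ((con 1ℤ :+ n) :+ t) := con (+ 2) :* (con 1ℤ :+ n) :+ con (+ 2) :* t) ≡.refl (+ n) (+ tri n))
  (≡.trans (cong (λ z → + 2 ℤ.* (1ℤ ℤ.+ + n) ℤ.+ z) (tri-formula n))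
    (solve 1 (λ n → con (+ 2) :* (con 1ℤ :+ n) :+ n :* (con 1ℤ :+ n) := (con 1ℤ :+ n) :* (con 1ℤ :+ (con 1ℤ :+ n))) ≡.refl (+ n)))
  where open +-*-Solver

-- Doubled to stay polynomial over ℤ; the factor 6 in `exponent` absorbs the 2.
pent-formula : ∀ l → + 2 ℤ.* + pent l ≡ l ℤ.* (+ 3 ℤ.* l ℤ.- 1ℤ)
pent-formula (+ zero)  = ≡.refl
pent-formula (+ suc m) = ≡.trans (cong (λ z → + 2 ℤ.* (z ℤ.+ + tri m)) (ℤₚ.pos-* (suc m) (suc m)))
  (≡.trans (solve 2 (λ m t → con (+ 2) :* ((con 1ℤ :+ m) :* (con 1ℤ :+ m) :+ t) := con (+ 2) :* ((con 1ℤ :+ m) :* (con 1ℤ :+ m)) :+ con (+ 2) :* t) ≡.refl (+ m) (+ tri m))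
  (≡.trans (cong (λ z → + 2 ℤ.* ((1ℤ ℤ.+ + m) ℤ.* (1ℤ ℤ.+ + m)) ℤ.+ z) (tri-formula m))
    (solve 1 (λ m → con (+ 2) :* ((con 1ℤ :+ m) :* (con 1ℤ :+ m)) :+ m :* (con 1ℤ :+ m) := (con 1ℤ :+ m) :* (con (+ 3) :* (con 1ℤ :+ m) :- con 1ℤ)) ≡.refl (+ m))))
  where open +-*-Solver
pent-formula -[1+ m ] = ≡.trans (cong (λ z → + 2 ℤ.* (z ℤ.+ + tri (suc m))) (ℤₚ.pos-* (suc m) (suc m)))
  (≡.trans (solve 2 (λ m t → con (+ 2) :* (m :* m :+ t) := con (+ 2) :* (m :* m) :+ con (+ 2) :* t) ≡.refl (+ suc m) (+ tri (suc m)))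
  (≡.trans (cong (λ z → + 2 ℤ.* (+ suc m ℤ.* + suc m) ℤ.+ z) (tri-formula (suc m)))
    (solve 1 (λ m → con (+ 2) :* (m :* m) :+ m :* (con 1ℤ :+ m) := (:- m) :* (con (+ 3) :* (:- m) :- con 1ℤ)) ≡.refl (+ suc m))))
  where open +-*-Solver

hex-formula : ∀ k → + hex k ≡ k ℤ.* (+ 2 ℤ.* k ℤ.- 1ℤ)
hex-formula (+ zero)  = ≡.refl
hex-formula (+ suc m) = ≡.trans (ℤₚ.pos-* (suc m) (2 ℕ.* m ℕ.+ 1)) (≡.trans (cong (λ z → + suc m ℤ.* (z ℤ.+ 1ℤ)) (ℤₚ.pos-* 2 m))
  (solve 1 (λ m → (con 1ℤ :+ m) :* (con (+ 2) :* m :+ con 1ℤ) := (con 1ℤ :+ m) :* (con (+ 2) :* (con 1ℤ :+ m) :- con 1ℤ)) ≡.refl (+ m)))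
  where open +-*-Solver
hex-formula -[1+ m ] = ≡.trans (ℤₚ.pos-* (suc m) (2 ℕ.* suc m ℕ.+ 1)) (≡.trans (cong (λ z → + suc m ℤ.* (z ℤ.+ 1ℤ)) (ℤₚ.pos-* 2 (suc m)))
  (solve 1 (λ m → m :* (con (+ 2) :* m :+ con 1ℤ) := (:- m) :* (con (+ 2) :* (:- m) :- con 1ℤ)) ≡.refl (+ suc m)))
  where open +-*-Solver

exponent : ℤ × ℤ → ℕ
exponent (k , l) = hex k ℕ.+ 6 ℕ.* pent l

exponent-formula : ∀ k l → + exponent (k , l) ≡ k ℤ.* (+ 2 ℤ.* k ℤ.- 1ℤ) ℤ.+ + 3 ℤ.* (l ℤ.* (+ 3 ℤ.* l ℤ.- 1ℤ))
exponent-formula k l = cong₂ ℤ._+_ (hex-formula k)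
  (≡.trans (ℤₚ.pos-* 6 (pent l)) (≡.trans (solve 1 (λ p → con (+ 6) :* p := con (+ 3) :* (con (+ 2) :* p)) ≡.refl (+ pent l))
    (cong (+ 3 ℤ.*_) (pent-formula l))))
  where open +-*-Solver

-- Together with `pent-bound`, this confines all solutions with exponent at most N to the window of
-- radius N.
hex-bound : ∀ k → ∣ k ∣ ≤ hex k
hex-bound (+ zero)  = z≤n
hex-bound (+ suc m) rewrite ℕₚ.+-comm (2 ℕ.* m) 1 = ℕₚ.m≤m*n (suc m) (suc (2 ℕ.* m))
hex-bound -[1+ m ]  = ℕₚ.m≤m*n (suc m) (2 ℕ.* suc m ℕ.+ 1)

pent-bound : ∀ l → ∣ l ∣ ≤ pent l
pent-bound (+ zero)  = z≤n
pent-bound (+ suc m) = ℕₚ.≤-trans (ℕₚ.m≤m*n (suc m) (suc m)) (ℕₚ.m≤m+n _ _)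
pent-bound -[1+ m ]  = ℕₚ.≤-trans (ℕₚ.m≤m*n (suc m) (suc m)) (ℕₚ.m≤m+n _ _)

-- For x = 4k − 1 and y = 6l − 1, right p is the image of left p under multiplication of
-- x + y√−2 by (1 − √−2)/(1 + √−2), up to the sign of x; parametrise below shows that
-- every solution of exponent (k , l) = 9a + 6 arises in one of the two ways.
left right : ℤ × ℤ → ℤ × ℤ
left  (t , s) = + 3 ℤ.* t , 1ℤ ℤ.- t ℤ.+ + 3 ℤ.* s
right (t , s) = + 2 ℤ.- + 3 ℤ.* t ℤ.+ + 6 ℤ.* s , ℤ.- t ℤ.- s

-- The multiplier has norm 1, so x² + 2y² is preserved.
exponent-left≡right : ∀ p → exponent (left p) ≡ exponent (right p)
exponent-left≡right p@(t , s) = ℤₚ.+-injective (≡.trans (exponent-formula (proj₁ (left p)) (proj₂ (left p)))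
  (≡.trans
    (solve 2 (λ t s →
        con (+ 3) :* t :* (con (+ 2) :* (con (+ 3) :* t) :- con 1ℤ)
          :+ con (+ 3) :* ((con 1ℤ :- t :+ con (+ 3) :* s) :* (con (+ 3) :* (con 1ℤ :- t :+ con (+ 3) :* s) :- con 1ℤ))
        := (con (+ 2) :- con (+ 3) :* t :+ con (+ 6) :* s) :* (con (+ 2) :* (con (+ 2) :- con (+ 3) :* t :+ con (+ 6) :* s) :- con 1ℤ)
          :+ con (+ 3) :* ((:- t :- s) :* (con (+ 3) :* (:- t :- s) :- con 1ℤ))) ≡.refl t s)
    (≡.sym (exponent-formula (proj₁ (right p)) (proj₂ (right p))))))
  where open +-*-Solver

parity-left≡-right : ∀ p → parity (proj₂ (left p)) ≡ ℤ.- parity (proj₂ (right p))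
parity-left≡-right (t , s) = begin
  parity (1ℤ ℤ.- t ℤ.+ + 3 ℤ.* s)
    -- The two values of l differ by the odd number 1 + 4s.
    ≡⟨ cong parity (solve 2 (λ t s → con 1ℤ :- t :+ con (+ 3) :* s := con 1ℤ :+ ((:- t :- s) :+ (con (+ 2) :* s :+ con (+ 2) :* s))) ≡.refl t s) ⟩
  parity (ℤ.suc (ℤ.- t ℤ.- s ℤ.+ (+ 2 ℤ.* s ℤ.+ + 2 ℤ.* s)))
    ≡⟨ parity-suc (ℤ.- t ℤ.- s ℤ.+ (+ 2 ℤ.* s ℤ.+ + 2 ℤ.* s)) ⟩
  ℤ.- parity (ℤ.- t ℤ.- s ℤ.+ (+ 2 ℤ.* s ℤ.+ + 2 ℤ.* s))
    ≡⟨ cong ℤ.-_ (≡.trans (parity-+ (ℤ.- t ℤ.- s) _) (≡.trans (cong (parity (ℤ.- t ℤ.- s) ℤ.*_) (parity-even (+ 2 ℤ.* s))) (ℤₚ.*-identityʳ _))) ⟩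
  ℤ.- parity (ℤ.- t ℤ.- s) ∎
  where open +-*-Solver
        open ≡.≡-Reasoning

left-injective : ∀ {p r} → left p ≡ left r → p ≡ r
left-injective {t , s} {t′ , s′} eq with ℤₚ.*-cancelˡ-≡ (+ 3) t t′ (cong proj₁ eq)
... | ≡.refl = cong (t ,_) (ℤₚ.*-cancelˡ-≡ (+ 3) s s′ (∙-cancelˡ (1ℤ ℤ.- t) _ _ (cong proj₂ eq)))

right-injective : ∀ {p r} → right p ≡ right r → p ≡ r
right-injective {t , s} {t′ , s′} eq with ℤₚ.*-cancelˡ-≡ (+ 9) t t′ 9t≡9t′
  where
  open +-*-Solver
  9t≡9t′ : + 9 ℤ.* t ≡ + 9 ℤ.* t′
  9t≡9t′ = ≡.trans (formula t s) (≡.trans (cong₂ (λ k l → + 2 ℤ.- (k ℤ.+ + 6 ℤ.* l)) (cong proj₁ eq) (cong proj₂ eq)) (≡.sym (formula t′ s′)))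
    where
    -- On the image of `right`, k + 6l = 2 - 9t no longer involves s.
    formula : ∀ t s → + 9 ℤ.* t ≡ + 2 ℤ.- ((+ 2 ℤ.- + 3 ℤ.* t ℤ.+ + 6 ℤ.* s) ℤ.+ + 6 ℤ.* (ℤ.- t ℤ.- s))
    formula = solve 2 (λ t s → con (+ 9) :* t := con (+ 2) :- ((con (+ 2) :- con (+ 3) :* t :+ con (+ 6) :* s) :+ con (+ 6) :* (:- t :- s))) ≡.refl
... | ≡.refl = cong (t ,_) (ℤₚ.neg-injective (∙-cancelˡ (ℤ.- t) _ _ (cong proj₂ eq)))

multiple-of-3 : ∀ {n} i → + n ≡ + 3 ℤ.* i → 3 ℕ∣.∣ n
multiple-of-3 {n} i eq = ℤ∣.∣⇒∣ᵤ {+ 3} {+ n} (ℤ∣.divides i (≡.trans eq (ℤₚ.*-comm (+ 3) i)))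

-- The first coordinates are 0 and 2 modulo 3. In terms of x and y, the left side has x ≡ y mod 3,
-- so 1 + √-2 divides x + y√-2; the right side has x ≡ -y, and the conjugate prime divides.
left≢right : ∀ p r → left p ≢ right r
left≢right (t , s) (t′ , s′) eq with multiple-of-3 {2} (t ℤ.+ t′ ℤ.- + 2 ℤ.* s′) 2≡
  where
  open +-*-Solver
  2≡ : + 2 ≡ + 3 ℤ.* (t ℤ.+ t′ ℤ.- + 2 ℤ.* s′)
  2≡ = ≡.trans (solve 2 (λ t s → con (+ 2) := (con (+ 2) :- con (+ 3) :* t :+ con (+ 6) :* s) :+ con (+ 3) :* (t :- con (+ 2) :* s)) ≡.refl t′ s′)
    (≡.trans (cong (ℤ._+ + 3 ℤ.* (t′ ℤ.- + 2 ℤ.* s′)) (≡.sym (cong proj₁ eq)))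
      (solve 3 (λ t t′ s → con (+ 3) :* t :+ con (+ 3) :* (t′ :- con (+ 2) :* s) := con (+ 3) :* (t :+ t′ :- con (+ 2) :* s)) ≡.refl t t′ s′))
... | ℕ∣.divides (suc (suc _)) ()

∣i∣≤∣n*i∣ : ∀ n i → ∣ i ∣ ≤ ∣ + suc n ℤ.* i ∣
∣i∣≤∣n*i∣ n i = ℕₚ.≤-trans (ℕₚ.m≤m+n ∣ i ∣ _) (ℕₚ.≤-reflexive (≡.sym (ℤₚ.abs-* (+ suc n) i)))

-- 3s = l - 1 + t bounds s by N + 1 + N, the radius used for `parameters`.
parameter-bound : ∀ {N} p → ∣ proj₁ (left p) ∣ ≤ N → ∣ proj₂ (left p) ∣ ≤ N →
          ∣ proj₁ p ∣ ≤ N ℕ.+ 1 ℕ.+ N × ∣ proj₂ p ∣ ≤ N ℕ.+ 1 ℕ.+ N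
parameter-bound {N} (t , s) k≤N l≤N = ℕₚ.≤-trans t≤N (ℕₚ.m≤n+m N _) , ℕₚ.≤-trans (∣i∣≤∣n*i∣ 2 s) 3s≤
  where
  t≤N : ∣ t ∣ ≤ N
  t≤N = ℕₚ.≤-trans (∣i∣≤∣n*i∣ 2 t) k≤N
  l : ℤ
  l = 1ℤ ℤ.- t ℤ.+ + 3 ℤ.* s
  3s≤ : ∣ + 3 ℤ.* s ∣ ≤ N ℕ.+ 1 ℕ.+ N
  3s≤ = begin
    ∣ + 3 ℤ.* s ∣            ≡⟨ cong ∣_∣ (solve 2 (λ t s → con (+ 3) :* s := con 1ℤ :- t :+ con (+ 3) :* s :- con 1ℤ :+ t) ≡.refl t s) ⟩
    ∣ l ℤ.- 1ℤ ℤ.+ t ∣       ≤⟨ ℤₚ.∣i+j∣≤∣i∣+∣j∣ (l ℤ.- 1ℤ) t ⟩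
    ∣ l ℤ.- 1ℤ ∣ ℕ.+ ∣ t ∣   ≤⟨ ℕₚ.+-monoˡ-≤ ∣ t ∣ (ℤₚ.∣i-j∣≤∣i∣+∣j∣ l 1ℤ) ⟩
    ∣ l ∣ ℕ.+ 1 ℕ.+ ∣ t ∣    ≤⟨ ℕₚ.+-mono-≤ (ℕₚ.+-monoˡ-≤ 1 l≤N) t≤N ⟩
    N ℕ.+ 1 ℕ.+ N            ∎
    where open ℕₚ.≤-Reasoning
          open +-*-Solver

module Solutions (N a : ℕ) (n≤N : 9 ℕ.* a ℕ.+ 6 ≤ N) where

  n : ℕ
  n = 9 ℕ.* a ℕ.+ 6

  solutions : List (ℤ × ℤ)
  solutions = filter (λ p → exponent p ℕₚ.≟ n) (cartesianProduct (window N) (window N))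

  parameters : List (ℤ × ℤ)
  parameters = filter (λ p → exponent (left p) ℕₚ.≟ n)
    (cartesianProduct (window (N ℕ.+ 1 ℕ.+ N)) (window (N ℕ.+ 1 ℕ.+ N)))

  solution-bound : ∀ p → exponent p ≡ n → ∣ proj₁ p ∣ ≤ N × ∣ proj₂ p ∣ ≤ N
  solution-bound (k , l) eq =
      ℕₚ.≤-trans (hex-bound k) (ℕₚ.≤-trans (ℕₚ.m≤m+n _ _) exponent≤N)
    , ℕₚ.≤-trans (pent-bound l) (ℕₚ.≤-trans (ℕₚ.m≤m+n _ _) (ℕₚ.≤-trans (ℕₚ.m≤n+m _ (hex k)) exponent≤N))
    where
    exponent≤N : exponent (k , l) ≤ N
    exponent≤N = ℕₚ.≤-trans (ℕₚ.≤-reflexive eq) n≤N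

  ∈-solutions : ∀ p → exponent p ≡ n → p ∈ solutions
  ∈-solutions p eq = ∈-filter⁺ (λ p → exponent p ℕₚ.≟ n)
    (∈-cartesianProduct⁺ (∈-window⁺ N (proj₁ (solution-bound p eq))) (∈-window⁺ N (proj₂ (solution-bound p eq)))) eq

  ∈-parameters : ∀ p → exponent (left p) ≡ n → p ∈ parameters
  ∈-parameters p eq = ∈-filter⁺ (λ p → exponent (left p) ℕₚ.≟ n)
    (∈-cartesianProduct⁺ (∈-window⁺ _ (proj₁ bounds)) (∈-window⁺ _ (proj₂ bounds))) eq
    where bounds = parameter-bound p (proj₁ (solution-bound (left p) eq)) (proj₂ (solution-bound (left p) eq))

  -- Modulo 3 the exponent is k(2k - 1), which has to vanish; this excludes k ≡ 1. Dividing by 3 and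
  -- reducing once more fixes l modulo 3.
  parametrise : ∀ p → exponent p ≡ n → (∃ λ r → p ≡ left r) ⊎ (∃ λ r → p ≡ right r)
  parametrise (k , l) eq = by-residue (k ℤDivMod.%ℕ 3) (k ℤDivMod./ℕ 3) (ℤDivMod.a≡a%ℕn+[a/ℕn]*n k 3) (ℤDivMod.n%ℕd<d k 3)
    where
    open +-*-Solver
    A : ℤ
    A = + a
    norm : k ℤ.* (+ 2 ℤ.* k ℤ.- 1ℤ) ℤ.+ + 3 ℤ.* (l ℤ.* (+ 3 ℤ.* l ℤ.- 1ℤ)) ≡ + 9 ℤ.* A ℤ.+ + 6
    norm = ≡.trans (≡.sym (exponent-formula k l)) (≡.trans (cong +_ eq) (cong (ℤ._+ + 6) (ℤₚ.pos-* 9 a)))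
    by-residue : ∀ r t → k ≡ + r ℤ.+ t ℤ.* + 3 → r < 3 → (∃ λ r → (k , l) ≡ left r) ⊎ (∃ λ r → (k , l) ≡ right r)
    by-residue 0 t ≡.refl _ = inj₁ ((t , s) , cong₂ _,_
        (solve 1 (λ t → con 0ℤ :+ t :* con (+ 3) := con (+ 3) :* t) ≡.refl t)
        (ℤₚ.*-cancelˡ-≡ (+ 3) l _ 3l≡))
      where
      s : ℤ
      -- For k = 3t the norm equation divided by 3 is 6t² - t + 3l² - l = 3A + 2; solving for the
      -- linear l gives l = 1 - t + 3s with this s.
      s = + 2 ℤ.* (t ℤ.* t) ℤ.+ l ℤ.* l ℤ.- A ℤ.- 1ℤ
      3l≡ : + 3 ℤ.* l ≡ + 3 ℤ.* (1ℤ ℤ.- t ℤ.+ + 3 ℤ.* s)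
      -- Add 9A + 6 - (9A + 6) and rewrite the first copy by `norm`; what remains is a polynomial
      -- identity in t, l and A.
      3l≡ = ≡.trans
        (solve 2 (λ l A → con (+ 3) :* l := con (+ 3) :* l :+ (con (+ 9) :* A :+ con (+ 6) :- (con (+ 9) :* A :+ con (+ 6)))) ≡.refl l A)
        (≡.trans (cong (λ z → + 3 ℤ.* l ℤ.+ (z ℤ.- (+ 9 ℤ.* A ℤ.+ + 6))) (≡.sym norm))
          (solve 3 (λ t l A →
              con (+ 3) :* l :+ ((con 0ℤ :+ t :* con (+ 3)) :* (con (+ 2) :* (con 0ℤ :+ t :* con (+ 3)) :- con 1ℤ)
                :+ con (+ 3) :* (l :* (con (+ 3) :* l :- con 1ℤ)) :- (con (+ 9) :* A :+ con (+ 6)))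
              := con (+ 3) :* (con 1ℤ :- t :+ con (+ 3) :* (con (+ 2) :* (t :* t) :+ l :* l :- A :- con 1ℤ))) ≡.refl t l A))
    by-residue 1 t ≡.refl _ = ⊥-elim (absurd (multiple-of-3 {1} s 1≡))
      where
      s : ℤ
      s = + 2 ℤ.+ + 3 ℤ.* A ℤ.- + 3 ℤ.* t ℤ.- + 6 ℤ.* (t ℤ.* t) ℤ.- + 3 ℤ.* (l ℤ.* l) ℤ.+ l
      absurd : 3 ℕ∣.∣ 1 → _
      absurd (ℕ∣.divides (suc _) ())
      1≡ : 1ℤ ≡ + 3 ℤ.* s
      1≡ = ≡.trans
        (solve 1 (λ A → con 1ℤ := con 1ℤ :+ (con (+ 9) :* A :+ con (+ 6) :- (con (+ 9) :* A :+ con (+ 6)))) ≡.refl A)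
        (≡.trans (cong (λ z → 1ℤ ℤ.+ (+ 9 ℤ.* A ℤ.+ + 6 ℤ.- z)) (≡.sym norm))
          (solve 3 (λ t l A →
              con 1ℤ :+ (con (+ 9) :* A :+ con (+ 6) :- ((con 1ℤ :+ t :* con (+ 3)) :* (con (+ 2) :* (con 1ℤ :+ t :* con (+ 3)) :- con 1ℤ)
                :+ con (+ 3) :* (l :* (con (+ 3) :* l :- con 1ℤ))))
              := con (+ 3) :* (con (+ 2) :+ con (+ 3) :* A :- con (+ 3) :* t :- con (+ 6) :* (t :* t) :- con (+ 3) :* (l :* l) :+ l)) ≡.refl t l A))
    -- Equating 2 + 3t with the first coordinate of `right` forces the first parameter 2s - t. Then
    -- l must be t - 3s, and the norm equation divided by 3 yields s.
    by-residue 2 t ≡.refl _ = inj₂ ((+ 2 ℤ.* s ℤ.- t , s) , cong₂ _,_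
        (solve 2 (λ t s → con (+ 2) :+ t :* con (+ 3) := con (+ 2) :- con (+ 3) :* (con (+ 2) :* s :- t) :+ con (+ 6) :* s) ≡.refl t s)
        (ℤₚ.*-cancelˡ-≡ (+ 3) l _ 3l≡))
      where
      s : ℤ
      s = A ℤ.- + 2 ℤ.* (t ℤ.* t) ℤ.- + 2 ℤ.* t ℤ.- l ℤ.* l
      3l≡ : + 3 ℤ.* l ≡ + 3 ℤ.* (ℤ.- (+ 2 ℤ.* s ℤ.- t) ℤ.- s)
      3l≡ = ≡.trans
        (solve 2 (λ l A → con (+ 3) :* l := con (+ 3) :* l :+ (con (+ 9) :* A :+ con (+ 6) :- (con (+ 9) :* A :+ con (+ 6)))) ≡.refl l A)
        (≡.trans (cong (λ z → + 3 ℤ.* l ℤ.+ (z ℤ.- (+ 9 ℤ.* A ℤ.+ + 6))) (≡.sym norm))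
          (solve 3 (λ t l A →
              con (+ 3) :* l :+ ((con (+ 2) :+ t :* con (+ 3)) :* (con (+ 2) :* (con (+ 2) :+ t :* con (+ 3)) :- con 1ℤ)
                :+ con (+ 3) :* (l :* (con (+ 3) :* l :- con 1ℤ)) :- (con (+ 9) :* A :+ con (+ 6)))
              := con (+ 3) :* (:- (con (+ 2) :* (A :- con (+ 2) :* (t :* t) :- con (+ 2) :* t :- l :* l) :- t)
                :- (A :- con (+ 2) :* (t :* t) :- con (+ 2) :* t :- l :* l))) ≡.refl t l A))
    by-residue (suc (suc (suc _))) t _ (s≤s (s≤s (s≤s ())))

  -- Both lists have the same members and no repetitions; the latter rests on the two injectivities
  -- and on `left≢right`.
  solutions-↭ : solutions ↭ map left parameters ++ map right parameters
  solutions-↭ = ∼bag⇒↭ (unique∧set⇒bag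
    (Unique.filter⁺ _ (Unique.cartesianProduct⁺ (window-unique N) (window-unique N)))
    (Unique.++⁺ (Unique.map⁺ left-injective parameters-unique) (Unique.map⁺ right-injective parameters-unique) disjoint)
    (λ {p} → mk⇔ (to {p}) from))
    where
    parameters-unique : Unique parameters
    parameters-unique = Unique.filter⁺ (λ p → exponent (left p) ℕₚ.≟ n) (Unique.cartesianProduct⁺ (window-unique (N ℕ.+ 1 ℕ.+ N)) (window-unique (N ℕ.+ 1 ℕ.+ N)))
    disjoint : ∀ {p} → p ∈ map left parameters × p ∈ map right parameters → _
    disjoint (p∈ , p∈′) with ∈-map⁻ left p∈ | ∈-map⁻ right p∈′
    ... | r , _ , ≡.refl | r′ , _ , eq = left≢right r r′ eq
    to : ∀ {p} → p ∈ solutions → p ∈ map left parameters ++ map right parameters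
    to {p} p∈ with proj₂ (∈-filter⁻ (λ p → exponent p ℕₚ.≟ n) {xs = cartesianProduct (window N) (window N)} p∈)
    ... | eq with parametrise p eq
    ...   | inj₁ (r , ≡.refl) = ∈-++⁺ˡ (∈-map⁺ left (∈-parameters r eq))
    ...   | inj₂ (r , ≡.refl) = ∈-++⁺ʳ (map left parameters) (∈-map⁺ right (∈-parameters r (≡.trans (exponent-left≡right r) eq)))
    parameters⁻ : ∀ {r} → r ∈ parameters → exponent (left r) ≡ n
    parameters⁻ r∈ = proj₂ (∈-filter⁻ (λ p → exponent (left p) ℕₚ.≟ n)
      {xs = cartesianProduct (window (N ℕ.+ 1 ℕ.+ N)) (window (N ℕ.+ 1 ℕ.+ N))} r∈)
    from : ∀ {p} → p ∈ map left parameters ++ map right parameters → p ∈ solutions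
    from p∈ with ∈-++⁻ (map left parameters) p∈
    ... | inj₁ p∈ˡ with ∈-map⁻ left p∈ˡ
    ...   | r , r∈ , ≡.refl = ∈-solutions (left r) (parameters⁻ r∈)
    from p∈ | inj₂ p∈ʳ with ∈-map⁻ right p∈ʳ
    ...   | r , r∈ , ≡.refl = ∈-solutions (right r) (≡.trans (≡.sym (exponent-left≡right r)) (parameters⁻ r∈))

  theta-coefficient : ℤΣ.∑ (λ p → parity (proj₂ p) ℤ.* X (exponent p) n) (cartesianProduct (window N) (window N)) ≡ 0ℤ
  theta-coefficient = begin
    ℤΣ.∑ (λ p → parity (proj₂ p) ℤ.* X (exponent p) n) (cartesianProduct (window N) (window N))
      ≡⟨ ∑-X (λ p → parity (proj₂ p)) exponent n (cartesianProduct (window N) (window N)) ⟩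
    ℤΣ.∑ (λ p → parity (proj₂ p)) solutions
      ≡⟨ ∑-↭ (λ p → parity (proj₂ p)) solutions-↭ ⟩
    ℤΣ.∑ (λ p → parity (proj₂ p)) (map left parameters ++ map right parameters)
      ≡⟨ ∑-cancel (λ p → parity (proj₂ p)) left right parity-left≡-right parameters ⟩
    0ℤ ∎
    where open ≡.≡-Reasoning

-- Coloured partitions

if-≤ᵇ : ∀ {x y : ℕ} {m n} → m ≤ n → (if m ≤ᵇ n then x else y) ≡ x
if-≤ᵇ {m = m} {n} m≤n with m ≤ᵇ n | ℕₚ.≤⇒≤ᵇ m≤n
... | true | _ = ≡.refl

if-≰ᵇ : ∀ {x y : ℕ} {m n} → n < m → (if m ≤ᵇ n then x else y) ≡ y
if-≰ᵇ {m = m} {n} n<m with m ≤ᵇ n | ℕₚ.≤ᵇ⇒≤ m n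
... | true  | m≤n = ⊥-elim (ℕₚ.<⇒≱ n<m (m≤n _))
... | false | _   = ≡.refl

-- The bound on the multiplicity is fuel: multiplicities i with i · d > n contribute 0.
sumMult-const : ∀ d ds n b k → (∀ i → b < i → n < i ℕ.* d) → sumMult d ds n (k ℕ.+ b) ≡ sumMult d ds n b
sumMult-const d ds n b zero    large = ≡.refl
sumMult-const d ds n b (suc k) large =
  cong₂ ℕ._+_ (if-≰ᵇ {x = ways ds (n ℕ.∸ suc (k ℕ.+ b) ℕ.* d)} (large (suc (k ℕ.+ b)) (s≤s (ℕₚ.m≤n+m b k)))) (sumMult-const d ds n b k large)

-- Removing one copy of d turns multiplicity i + 1 in d + n into multiplicity i in n; multiplicity 0
-- is split off.
sumMult-shift : ∀ d ds n b → sumMult d ds (d ℕ.+ n) (suc b) ≡ ways ds (d ℕ.+ n) ℕ.+ sumMult d ds n b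
sumMult-shift d ds n zero = begin
  (if 1 ℕ.* d ≤ᵇ d ℕ.+ n then ways ds (d ℕ.+ n ℕ.∸ 1 ℕ.* d) else 0) ℕ.+ ways ds (d ℕ.+ n)
    ≡⟨ cong (ℕ._+ ways ds (d ℕ.+ n)) (if-≤ᵇ (ℕₚ.≤-trans (ℕₚ.≤-reflexive (ℕₚ.*-identityˡ d)) (ℕₚ.m≤m+n d n))) ⟩
  ways ds (d ℕ.+ n ℕ.∸ 1 ℕ.* d) ℕ.+ ways ds (d ℕ.+ n)
    ≡⟨ cong (λ e → ways ds e ℕ.+ ways ds (d ℕ.+ n)) (≡.trans (cong (d ℕ.+ n ℕ.∸_) (ℕₚ.*-identityˡ d)) (ℕₚ.m+n∸m≡n d n)) ⟩
  ways ds n ℕ.+ ways ds (d ℕ.+ n)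
    ≡⟨ ℕₚ.+-comm (ways ds n) _ ⟩
  ways ds (d ℕ.+ n) ℕ.+ ways ds n ∎
  where open ≡.≡-Reasoning
sumMult-shift d ds n (suc b) = begin
  (if suc (suc b) ℕ.* d ≤ᵇ d ℕ.+ n then ways ds (d ℕ.+ n ℕ.∸ suc (suc b) ℕ.* d) else 0) ℕ.+ sumMult d ds (d ℕ.+ n) (suc b)
    ≡⟨ cong₂ ℕ._+_ summand (sumMult-shift d ds n b) ⟩
  (if suc b ℕ.* d ≤ᵇ n then ways ds (n ℕ.∸ suc b ℕ.* d) else 0) ℕ.+ (ways ds (d ℕ.+ n) ℕ.+ sumMult d ds n b)
    ≡⟨ ℕSolver.+-*-Solver.solve 3 (λ a b c → a :+ (b :+ c) := b :+ (a :+ c)) ≡.refl _ (ways ds (d ℕ.+ n)) (sumMult d ds n b) ⟩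
  ways ds (d ℕ.+ n) ℕ.+ sumMult d ds n (suc b) ∎
  where
  open ≡.≡-Reasoning
  open ℕSolver.+-*-Solver using (_:+_; _:=_)
  summand : (if suc (suc b) ℕ.* d ≤ᵇ d ℕ.+ n then ways ds (d ℕ.+ n ℕ.∸ suc (suc b) ℕ.* d) else 0)
          ≡ (if suc b ℕ.* d ≤ᵇ n then ways ds (n ℕ.∸ suc b ℕ.* d) else 0)
  summand with suc b ℕ.* d ℕₚ.≤? n
  ... | yes le = ≡.trans (if-≤ᵇ (ℕₚ.+-monoʳ-≤ d le)) (≡.trans (cong (ways ds) (ℕₚ.[m+n]∸[m+o]≡n∸o d n _)) (≡.sym (if-≤ᵇ le)))
  ... | no  gt = ≡.trans (if-≰ᵇ (ℕₚ.+-monoʳ-< d (ℕₚ.≰⇒> gt))) (≡.sym (if-≰ᵇ (ℕₚ.≰⇒> gt)))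

-- Either the part does not occur or one copy of it can be removed. The shift leaves the
-- multiplicity bound d + n, which `sumMult-const` lowers to the n in the definition of `ways`.
ways-shift : ∀ d ds n → ways (suc d ∷ ds) (suc d ℕ.+ n) ≡ ways ds (suc d ℕ.+ n) ℕ.+ ways (suc d ∷ ds) n
ways-shift d ds n = ≡.trans (sumMult-shift (suc d) ds n (d ℕ.+ n))
  (cong (ways ds (suc d ℕ.+ n) ℕ.+_) (sumMult-const (suc d) ds n n d λ i n<i → ℕₚ.≤-trans n<i (ℕₚ.m≤m*n i (suc d))))

ways-small : ∀ d ds n → n < d → ways (d ∷ ds) n ≡ ways ds n
ways-small d ds n n<d = ≡.trans (cong (sumMult d ds n) (≡.sym (ℕₚ.+-identityʳ n)))
  (sumMult-const d ds n 0 n λ { (suc i) _ → ℕₚ.≤-trans n<d (ℕₚ.m≤m+n d (i ℕ.* d)) })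

waysSeries : List ℕ → Series
waysSeries ds n = + ways ds n

kinds-positive : ∀ r s n → All (0 <_) (kinds r s n)
kinds-positive r s zero    = []
kinds-positive r s (suc n) = Allₚ.++⁺ (Allₚ.replicate⁺ _ (s≤s z≤n)) (kinds-positive r s n)

even-double : ∀ m → even? (m ℕ.* 2) ≡ true
even-double zero    = ≡.refl
even-double (suc m) = even-double m

odd-double : ∀ m → even? (suc (m ℕ.* 2)) ≡ false
odd-double zero    = ≡.refl
odd-double (suc m) = odd-double m

-- The generating function modulo 3 and q^(N + 1)

module ModuloThree (N : ℕ) where

  open Truncated N
  open CommutativeRing seriesRing hiding (_≈_; zero)
  open Theta seriesRing
  open Solver using (solve; _:+_; _:*_; _:-_; :-_; _:=_; con)
  open import Relation.Binary.Reasoning.Setoid setoid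

  q : Series
  q = X 1

  q^≈X : ∀ d → q ^ d ≈ X d
  q^≈X zero    = refl
  q^≈X (suc d) = trans (*-congˡ (q^≈X d)) (pointwise (X-+ 1 d))

  q^-vanishes : ∀ {d} → N < d → q ^ d ≈ 0#
  q^-vanishes {d} N<d = trans (q^≈X d)
    (mk≈ λ n n≤N → ≡₃-reflexive (X-off-diagonal d n λ { ≡.refl → ℕₚ.<⇒≱ N<d n≤N }))

  3≈0 : 1# + 1# + 1# ≈ 0#
  3≈0 .at zero    _ = mod₃ (ℤ∣.divides 1ℤ ≡.refl)
  3≈0 .at (suc n) _ = ≡₃-reflexive ≡.refl

  open Characteristic₃ 3≈0

  ways-∷ : ∀ d ds → 0 < d → (1# - q ^ d) * waysSeries (d ∷ ds) ≈ waysSeries ds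
  ways-∷ d@(suc d-1) ds _ = begin
    (1# - q ^ d) * waysSeries (d ∷ ds)
      ≈⟨ *-congʳ (1-‿cong (q^≈X d)) ⟩
    (1# - X d) * waysSeries (d ∷ ds)
      ≈⟨ *-congˡ (pointwise unfold) ⟩
    (1# - X d) * (waysSeries ds + X d * waysSeries (d ∷ ds))
      ≈⟨ cancel ⟩
    waysSeries ds ∎
    where
    unfold : ∀ n → waysSeries (d ∷ ds) n ≡ (waysSeries ds ⊕ X d ⊛ waysSeries (d ∷ ds)) n
    unfold n with d ℕₚ.≤? n
    ... | no  d≰n = ≡.trans (cong +_ (ways-small d ds n (ℕₚ.≰⇒> d≰n)))
      (≡.trans (≡.sym (ℤₚ.+-identityʳ _)) (cong (λ z → waysSeries ds n ℤ.+ z) (≡.sym (X-⊛-< d _ n (ℕₚ.≰⇒> d≰n)))))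
    ... | yes d≤n = subst (λ n → waysSeries (d ∷ ds) n ≡ (waysSeries ds ⊕ X d ⊛ waysSeries (d ∷ ds)) n) (ℕₚ.m+[n∸m]≡n d≤n)
      (≡.trans (cong +_ (ways-shift d-1 ds (n ℕ.∸ d))) (cong (λ z → waysSeries ds (d ℕ.+ (n ℕ.∸ d)) ℤ.+ z) (≡.sym (X-⊛-≥ d _ (n ℕ.∸ d)))))
    equation : waysSeries (d ∷ ds) ≈ waysSeries ds + X d * waysSeries (d ∷ ds)
    equation = pointwise unfold
    cancel : (1# - X d) * (waysSeries ds + X d * waysSeries (d ∷ ds)) ≈ waysSeries ds
    cancel = begin
      (1# - X d) * (waysSeries ds + X d * waysSeries (d ∷ ds))
        ≈⟨ *-congˡ equation ⟨
      (1# - X d) * waysSeries (d ∷ ds)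
        ≈⟨ solve 2 (λ x w → (con 1ℤ :- x) :* w := w :- x :* w) refl (X d) (waysSeries (d ∷ ds)) ⟩
      waysSeries (d ∷ ds) - X d * waysSeries (d ∷ ds)
        ≈⟨ +-congʳ equation ⟩
      waysSeries ds + X d * waysSeries (d ∷ ds) - X d * waysSeries (d ∷ ds)
        ≈⟨ solve 2 (λ w y → w :+ y :- y := w) refl (waysSeries ds) (X d * waysSeries (d ∷ ds)) ⟩
      waysSeries ds ∎

  ways-[] : waysSeries [] ≈ 1#
  ways-[] = pointwise λ { zero → ≡.refl ; (suc n) → ≡.refl }

  denominator : List ℕ → Series
  denominator []       = 1#
  denominator (d ∷ ds) = (1# - q ^ d) * denominator ds

  ways-denominator : ∀ {ds} → All (0 <_) ds → waysSeries ds * denominator ds ≈ 1#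
  ways-denominator []                     = trans (*-identityʳ _) ways-[]
  ways-denominator {d ∷ ds} (0<d ∷ 0<ds) = begin
    waysSeries (d ∷ ds) * ((1# - q ^ d) * denominator ds)
      ≈⟨ solve 3 (λ w x y → w :* (x :* y) := x :* w :* y) refl (waysSeries (d ∷ ds)) (1# - q ^ d) (denominator ds) ⟩
    (1# - q ^ d) * waysSeries (d ∷ ds) * denominator ds
      ≈⟨ *-congʳ (ways-∷ d ds 0<d) ⟩
    waysSeries ds * denominator ds
      ≈⟨ ways-denominator 0<ds ⟩
    1# ∎

  denominator-replicate : ∀ c d ds → denominator (replicate c d ++ ds) ≈ (1# - q ^ d) ^ c * denominator ds
  denominator-replicate zero    d ds = sym (*-identityˡ _)
  denominator-replicate (suc c) d ds = trans (*-congˡ (denominator-replicate c d ds)) (sym (*-assoc _ _ _))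

  evenFactor oddFactor : ℕ → Series
  evenFactor i       = 1# - q ^ (2 ℕ.* i)
  oddFactor  zero    = 1#
  oddFactor  (suc i) = 1# - q ^ (2 ℕ.* i ℕ.+ 1)

  -- An even limit pairs every odd size with the next even one, so both products have m factors.
  denominator-kinds-double : ∀ r s m → denominator (kinds r s (m ℕ.* 2)) ≈ ∏ evenFactor 0 m ^ r * ∏ oddFactor 0 m ^ s
  denominator-kinds-double r s zero = sym (trans (*-cong (∏-^ evenFactor 0 0 r) (∏-^ oddFactor 0 0 s)) (*-identityˡ _))
  denominator-kinds-double r s (suc m) rewrite even-double m | odd-double m = begin
    denominator (replicate r (suc (suc (m ℕ.* 2))) ++ replicate s (suc (m ℕ.* 2)) ++ kinds r s (m ℕ.* 2))
      ≈⟨ trans (denominator-replicate r _ _) (*-congˡ (denominator-replicate s _ _)) ⟩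
    (1# - q ^ suc (suc (m ℕ.* 2))) ^ r * ((1# - q ^ suc (m ℕ.* 2)) ^ s * denominator (kinds r s (m ℕ.* 2)))
      ≈⟨ *-cong (^-congˡ r (1-‿cong (^-congʳ q (ℕₚ.*-comm (suc m) 2))))
                (*-cong (^-congˡ s (1-‿cong (^-congʳ q (≡.trans (cong suc (ℕₚ.*-comm m 2)) (ℕₚ.+-comm 1 (2 ℕ.* m))))))
                        (denominator-kinds-double r s m)) ⟩
    evenFactor (suc m) ^ r * (oddFactor (suc m) ^ s * (∏ evenFactor 0 m ^ r * ∏ oddFactor 0 m ^ s))
      ≈⟨ solve 4 (λ a b c d → a :* (b :* (c :* d)) := (c :* a) :* (d :* b)) refl
           (evenFactor (suc m) ^ r) (oddFactor (suc m) ^ s) (∏ evenFactor 0 m ^ r) (∏ oddFactor 0 m ^ s) ⟩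
    (∏ evenFactor 0 m ^ r * evenFactor (suc m) ^ r) * (∏ oddFactor 0 m ^ s * oddFactor (suc m) ^ s)
      ≈⟨ *-cong (trans (sym (^-distrib-* _ _ r)) (^-congˡ r (sym (∏-snoc evenFactor 0 m))))
                (trans (sym (^-distrib-* _ _ s)) (^-congˡ s (sym (∏-snoc oddFactor 0 m)))) ⟩
    ∏ evenFactor 0 (suc m) ^ r * ∏ oddFactor 0 (suc m) ^ s ∎

  -- Factors 1 - q^d with d > N equal 1 here. This permits the limit 2N in place of N, whatever the
  -- parity of N.
  denominator-kinds-≥ : ∀ r s j → denominator (kinds r s (j ℕ.+ N)) ≈ denominator (kinds r s N)
  denominator-kinds-≥ r s zero    = refl
  denominator-kinds-≥ r s (suc j) = begin
    denominator (kinds r s (suc j ℕ.+ N))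
      ≈⟨ denominator-replicate c (suc j ℕ.+ N) (kinds r s (j ℕ.+ N)) ⟩
    (1# - q ^ (suc j ℕ.+ N)) ^ c * denominator (kinds r s (j ℕ.+ N))
      ≈⟨ *-cong (^-congˡ c (trans (1-‿cong (q^-vanishes (s≤s (ℕₚ.m≤n+m N j))))
                                  (solve 0 (con 1ℤ :- con 0ℤ := con 1ℤ) refl)))
                (denominator-kinds-≥ r s j) ⟩
    1# ^ c * denominator (kinds r s N)
      ≈⟨ trans (*-congʳ (1^ c)) (*-identityˡ _) ⟩
    denominator (kinds r s N) ∎
    where
    c : ℕ
    c = if even? (suc j ℕ.+ N) then r else s

  -- Modulo q^(N + 1), `A` is f₂ and `B` is f₁/f₂; `P` below is the quotient f₂²/f₁.
  A B : Series
  A = ∏ evenFactor 0 N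
  B = ∏ oddFactor 0 N

  ways-kinds : ∀ r s → waysSeries (kinds r s N) * (A ^ r * B ^ s) ≈ 1#
  ways-kinds r s = begin
    waysSeries (kinds r s N) * (A ^ r * B ^ s)
      ≈⟨ *-congˡ (denominator-kinds-double r s N) ⟨
    waysSeries (kinds r s N) * denominator (kinds r s (N ℕ.* 2))
      ≡⟨ cong (λ m → waysSeries (kinds r s N) * denominator (kinds r s m))
           (≡.trans (ℕₚ.*-comm N 2) (cong (λ m → N ℕ.+ m) (ℕₚ.+-identityʳ N))) ⟩
    waysSeries (kinds r s N) * denominator (kinds r s (N ℕ.+ N))
      ≈⟨ *-congˡ (denominator-kinds-≥ r s N) ⟩
    waysSeries (kinds r s N) * denominator (kinds r s N)
      ≈⟨ ways-denominator (kinds-positive r s N) ⟩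
    1# ∎

  -- The geometric series 1/(1 - q^(2i+1)), obtained by counting partitions whose only part size is
  -- 2i + 1.
  oddInverse : ℕ → Series
  oddInverse i = waysSeries (2 ℕ.* i ℕ.+ 1 ∷ [])

  oddFactor-inverse : ∀ i → (1# - q ^ (2 ℕ.* i ℕ.+ 1)) * oddInverse i ≈ 1#
  oddFactor-inverse i = trans (ways-∷ (2 ℕ.* i ℕ.+ 1) [] (ℕₚ.m≤n+m 1 (2 ℕ.* i))) ways-[]

  module Gauss-q = Gauss q oddInverse oddFactor-inverse
  module Euler-q⁶ = Euler (q ^ 6)

  P : Series
  P = ∏ Gauss-q.factor 0 N

  A≈P*B : A ≈ P * B
  A≈P*B = sym (trans (∏-* Gauss-q.factor oddFactor 0 N) (∏-cong unit 0 N))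
    where
    unit : ∀ i → Gauss-q.factor (suc i) * oddFactor (suc i) ≈ evenFactor (suc i)
    unit i = begin
      evenFactor (suc i) * oddInverse i * oddFactor (suc i)
        ≈⟨ solve 3 (λ a b c → a :* b :* c := a :* (c :* b)) refl (evenFactor (suc i)) (oddInverse i) (oddFactor (suc i)) ⟩
      evenFactor (suc i) * (oddFactor (suc i) * oddInverse i)
        ≈⟨ *-congˡ (oddFactor-inverse i) ⟩
      evenFactor (suc i) * 1#
        ≈⟨ *-identityʳ _ ⟩
      evenFactor (suc i) ∎

  A³≈ : A ^ 3 ≈ ∏ Euler-q⁶.factor 0 N
  A³≈ = trans (∏-^ evenFactor 0 N 3) (∏-cong (λ i → trans (cube (q ^ (2 ℕ.* suc i))) (1-‿cong (power (suc i)))) 0 N)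
    where
    power : ∀ i → (q ^ (2 ℕ.* i)) ^ 3 ≈ (q ^ 6) ^ i
    power i = trans (^-assocʳ q (2 ℕ.* i) 3) (trans
      (^-congʳ q (ℕSolver.+-*-Solver.solve 1 (λ i → (ℕSolver.+-*-Solver.con 2 ⊗ i) ⊗ ℕSolver.+-*-Solver.con 3 ≜ ℕSolver.+-*-Solver.con 6 ⊗ i) ≡.refl i))
      (sym (^-assocʳ q 6 i)))
      where open ℕSolver.+-*-Solver using () renaming (_:*_ to _⊗_; _:=_ to _≜_)

  sign-* : ∀ m f → sign m * f ≈ (ℤΣ.sign m • f)
  sign-* zero    f = pointwise λ n → constant-⊛ 1ℤ f n
  sign-* (suc m) f = begin
    - sign m * f           ≈⟨ solve 2 (λ s f → (:- s) :* f := :- (s :* f)) refl (sign m) f ⟩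
    - (sign m * f)         ≈⟨ -‿cong (sign-* m f) ⟩
    - (ℤΣ.sign m • f)      ≈⟨ pointwise (λ n → ℤₚ.neg-distribˡ-* (ℤΣ.sign m) (f n)) ⟩
    ℤΣ.sign (suc m) • f    ∎

  theta : Series
  theta = ∑ (λ p → parity (proj₂ p) • X (exponent p)) (cartesianProduct (window N) (window N))

  A³P≈theta : A ^ 3 * P ≈ theta
  A³P≈theta = begin
    A ^ 3 * P
      ≈⟨ trans (*-comm _ _) (*-cong (Gauss-q.triangular N (q^-vanishes ℕₚ.≤-refl))
           (trans A³≈ (Euler-q⁶.pentagonal N (trans (^-assocʳ q 6 (suc N)) (q^-vanishes (ℕₚ.m≤m+n (suc N) _)))))) ⟩
    ∑ (λ k → q ^ hex k) (window N) * ∑ (λ l → sign ∣ l ∣ * (q ^ 6) ^ pent l) (window N)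
      ≈⟨ ∑-*-∑ _ _ (window N) (window N) ⟩
    ∑ (λ (k , l) → q ^ hex k * (sign ∣ l ∣ * (q ^ 6) ^ pent l)) (cartesianProduct (window N) (window N))
      ≈⟨ ∑-cong monomial (cartesianProduct (window N) (window N)) ⟩
    theta ∎
    where
    monomial : ∀ p → q ^ hex (proj₁ p) * (sign ∣ proj₂ p ∣ * (q ^ 6) ^ pent (proj₂ p)) ≈ (parity (proj₂ p) • X (exponent p))
    monomial (k , l) = begin
      q ^ hex k * (sign ∣ l ∣ * (q ^ 6) ^ pent l)
        ≈⟨ solve 3 (λ a b c → a :* (b :* c) := b :* (a :* c)) refl (q ^ hex k) (sign ∣ l ∣) ((q ^ 6) ^ pent l) ⟩
      sign ∣ l ∣ * (q ^ hex k * (q ^ 6) ^ pent l)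
        ≈⟨ *-congˡ (trans (*-congˡ (^-assocʳ q 6 (pent l))) (trans (sym (^-homo-* q (hex k) (6 ℕ.* pent l))) (q^≈X (exponent (k , l))))) ⟩
      sign ∣ l ∣ * X (exponent (k , l))
        ≈⟨ sign-* ∣ l ∣ (X (exponent (k , l))) ⟩
      parity l • X (exponent (k , l)) ∎

  ∑-at : ∀ {A : Set} (f : A → Series) xs n → ∑ f xs n ≡ ℤΣ.∑ (λ x → f x n) xs
  ∑-at f []       n = ≡.refl
  ∑-at f (x ∷ xs) n = cong (λ z → f x n ℤ.+ z) (∑-at f xs n)

  -- Coefficients in the class 6 mod 9

  record Vanishing (f : Series) : Set where
    field coefficient : ∀ a → 9 ℕ.* a ℕ.+ 6 ≤ N → f (9 ℕ.* a ℕ.+ 6) ≡₃ 0ℤ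
  open Vanishing

  Vanishing-resp : ∀ {f g} → f ≈ g → Vanishing f → Vanishing g
  Vanishing-resp f≈g v .coefficient a n≤N = ≡₃-trans (≡₃-sym (at f≈g _ n≤N)) (coefficient v a n≤N)

  theta-vanishing : Vanishing theta
  theta-vanishing .coefficient a n≤N = ≡₃-reflexive
    (≡.trans (∑-at _ (cartesianProduct (window N) (window N)) _) (Solutions.theta-coefficient N a n≤N))

  -- This property of multipliers stands in for being a series in q⁹ with constant term 1: it passes
  -- to products and powers at once.
  record Cancellable (x : Series) : Set where
    field cancel : ∀ {f} → Vanishing (x * f) → Vanishing f
  open Cancellable

  Cancellable-resp : ∀ {x y} → x ≈ y → Cancellable x → Cancellable y
  Cancellable-resp x≈y c .cancel v = cancel c (Vanishing-resp (*-congʳ (sym x≈y)) v)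

  Cancellable-1 : Cancellable 1#
  Cancellable-1 .cancel = Vanishing-resp (*-identityˡ _)

  Cancellable-* : ∀ {x y} → Cancellable x → Cancellable y → Cancellable (x * y)
  Cancellable-* cx cy .cancel v = cancel cy (cancel cx (Vanishing-resp (*-assoc _ _ _) v))

  Cancellable-^ : ∀ {x} n → Cancellable x → Cancellable (x ^ n)
  Cancellable-^ zero    c = Cancellable-1
  Cancellable-^ (suc n) c = Cancellable-* c (Cancellable-^ n c)

  Cancellable-∏ : ∀ {x} → (∀ i → Cancellable (x (suc i))) → ∀ s k → Cancellable (∏ x s k)
  Cancellable-∏ c s zero    = Cancellable-1
  Cancellable-∏ c s (suc k) = Cancellable-* (c s) (Cancellable-∏ c (suc s) k)

  -- f = (1 - q^(9d)) f + q^(9d) f, and coefficient 9a + 6 of the last summand is coefficient 9(a -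
  -- d) + 6 of f, or 0 if d > a. Strong induction on a applies because d > 0.
  Cancellable-X : ∀ d → 0 < d → Cancellable (1# - X (9 ℕ.* d))
  Cancellable-X d 0<d .cancel {f} v .coefficient = <-rec _ step
    where
    unfold : f ≈ (1# - X (9 ℕ.* d)) * f + X (9 ℕ.* d) * f
    unfold = solve 2 (λ x f → f := (con 1ℤ :- x) :* f :+ x :* f) refl (X (9 ℕ.* d)) f
    step : ∀ a → (∀ {b} → b < a → 9 ℕ.* b ℕ.+ 6 ≤ N → f (9 ℕ.* b ℕ.+ 6) ≡₃ 0ℤ) → 9 ℕ.* a ℕ.+ 6 ≤ N → f (9 ℕ.* a ℕ.+ 6) ≡₃ 0ℤ
    step a rec n≤N = ≡₃-trans (at unfold _ n≤N) (+-cong₃ (coefficient v a n≤N) shifted)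
      where
      shifted : (X (9 ℕ.* d) * f) (9 ℕ.* a ℕ.+ 6) ≡₃ 0ℤ
      shifted with d ℕₚ.≤? a
      ... | yes d≤a = ≡₃-trans (≡₃-reflexive (≡.trans (cong (X (9 ℕ.* d) * f) index) (X-⊛-≥ (9 ℕ.* d) f _)))
        (rec (ℕₚ.∸-monoʳ-< 0<d d≤a) (ℕₚ.≤-trans (ℕₚ.+-monoˡ-≤ 6 (ℕₚ.*-monoʳ-≤ 9 (ℕₚ.m∸n≤m a d))) n≤N))
        where
        index : 9 ℕ.* a ℕ.+ 6 ≡ 9 ℕ.* d ℕ.+ (9 ℕ.* (a ℕ.∸ d) ℕ.+ 6)
        index = ≡.trans (cong (λ a → 9 ℕ.* a ℕ.+ 6) (≡.sym (ℕₚ.m+[n∸m]≡n d≤a)))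
          (≡.trans (cong (ℕ._+ 6) (ℕₚ.*-distribˡ-+ 9 d (a ℕ.∸ d))) (ℕₚ.+-assoc (9 ℕ.* d) _ 6))
      ... | no  d≰a = ≡₃-reflexive (X-⊛-< (9 ℕ.* d) f _ small)
        where
        small : 9 ℕ.* a ℕ.+ 6 < 9 ℕ.* d
        small = ℕₚ.<-≤-trans (ℕₚ.+-monoʳ-< (9 ℕ.* a) (ℕₚ.m≤m+n 7 2))
          (ℕₚ.≤-trans (ℕₚ.≤-reflexive (≡.trans (ℕₚ.+-comm (9 ℕ.* a) 9) (≡.sym (ℕₚ.*-suc 9 a)))) (ℕₚ.*-monoʳ-≤ 9 (ℕₚ.≰⇒> d≰a)))

  Cancellable-ninth : ∀ d → 0 < d → Cancellable ((1# - q ^ d) ^ 9)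
  Cancellable-ninth d 0<d = Cancellable-resp (sym eq) (Cancellable-X d 0<d)
    where
    eq : (1# - q ^ d) ^ 9 ≈ 1# - X (9 ℕ.* d)
    eq = trans (ninth (q ^ d)) (1-‿cong
      (trans (^-assocʳ q d 9) (trans (^-congʳ q (ℕₚ.*-comm d 9)) (q^≈X (9 ℕ.* d)))))

  Cancellable-A⁹ : Cancellable (A ^ 9)
  Cancellable-A⁹ = Cancellable-resp (sym (∏-^ evenFactor 0 N 9))
    (Cancellable-∏ (λ i → Cancellable-ninth (2 ℕ.* suc i) (s≤s z≤n)) 0 N)

  Cancellable-B⁹ : Cancellable (B ^ 9)
  Cancellable-B⁹ = Cancellable-resp (sym (∏-^ oddFactor 0 N 9))
    (Cancellable-∏ (λ i → Cancellable-ninth (2 ℕ.* i ℕ.+ 1) (ℕₚ.m≤n+m 1 (2 ℕ.* i))) 0 N)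

  ways-vanishing : ∀ a b → Vanishing (waysSeries (kinds (9 ℕ.* a ℕ.+ 5) (9 ℕ.* b ℕ.+ 1) N))
  ways-vanishing a b = cancel (Cancellable-^ (suc a) Cancellable-A⁹) (cancel (Cancellable-^ b Cancellable-B⁹)
    (Vanishing-resp (sym eq) theta-vanishing))
    where
    W : Series
    W = waysSeries (kinds (9 ℕ.* a ℕ.+ 5) (9 ℕ.* b ℕ.+ 1) N)
    eq : (B ^ 9) ^ b * ((A ^ 9) ^ suc a * W) ≈ theta
    eq = begin
      (B ^ 9) ^ b * ((A ^ 9) ^ suc a * W)
        ≈⟨ *-cong (^-assocʳ B 9 b) (*-congʳ (trans (^-assocʳ A 9 (suc a)) (trans
             -- The surplus over 9a + 5 is A⁴ = A³ · A. Writing the last A as P · B supplies the B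
             -- that completes B^(9b) to B^(9b + 1).
             (^-congʳ A (ℕSolver.+-*-Solver.solve 1 (λ a → ⟨9⟩ ⊗ (⟨1⟩ ⊞ a) ≜ (⟨9⟩ ⊗ a ⊞ ⟨5⟩) ⊞ (⟨3⟩ ⊞ ⟨1⟩)) ≡.refl a))
             (trans (^-homo-* A (9 ℕ.* a ℕ.+ 5) _) (*-congˡ (^-homo-* A 3 1)))))) ⟩
      B ^ (9 ℕ.* b) * (A ^ (9 ℕ.* a ℕ.+ 5) * (A ^ 3 * (A * 1#)) * W)
        ≈⟨ *-congˡ (*-congʳ (*-congˡ (*-congˡ (*-congʳ A≈P*B)))) ⟩
      B ^ (9 ℕ.* b) * (A ^ (9 ℕ.* a ℕ.+ 5) * (A ^ 3 * (P * B * 1#)) * W)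
        ≈⟨ solve 6 (λ y x c p b w → y :* (x :* (c :* (p :* b :* con 1ℤ)) :* w) := w :* (x :* (y :* (b :* con 1ℤ))) :* (c :* p)) refl
             (B ^ (9 ℕ.* b)) (A ^ (9 ℕ.* a ℕ.+ 5)) (A ^ 3) P B W ⟩
      W * (A ^ (9 ℕ.* a ℕ.+ 5) * (B ^ (9 ℕ.* b) * B ^ 1)) * (A ^ 3 * P)
        ≈⟨ *-congʳ (trans (*-congˡ (*-congˡ (sym (^-homo-* B (9 ℕ.* b) 1)))) (ways-kinds (9 ℕ.* a ℕ.+ 5) (9 ℕ.* b ℕ.+ 1))) ⟩
      1# * (A ^ 3 * P)
        ≈⟨ trans (*-identityˡ _) A³P≈theta ⟩
      theta ∎
      where
      open ℕSolver.+-*-Solver using (Polynomial) renaming (_:*_ to _⊗_; _:+_ to _⊞_; _:=_ to _≜_; con to κ)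
      ⟨1⟩ ⟨3⟩ ⟨5⟩ ⟨9⟩ : Polynomial 1
      ⟨1⟩ = κ 1
      ⟨3⟩ = κ 3
      ⟨5⟩ = κ 5
      ⟨9⟩ = κ 9

open import Data.Nat using (_+_; _*_; _∸_)
open import Data.Nat.Divisibility using (_∣_)

theorem1p11 : (n j k : ℕ) → j ≤ k →
    3 ∣ a (9 * (k ∸ j) + 5) (9 * k + 1) (9 * n + 6)
theorem1p11 n j k _ = ℤ∣.∣⇒∣ᵤ {+ 3} {+ count} (subst (+ 3 ℤ∣.∣_) (ℤₚ.+-identityʳ (+ count))
  (_≡₃_.divides₃ (ModuloThree.Vanishing.coefficient (ModuloThree.ways-vanishing N (k ℕ.∸ j) k) n ℕₚ.≤-refl)))
  where
  -- Truncating exactly at the coefficient in question makes `kinds r s N` the very list that `a`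
  -- uses.
  N count : ℕ
  N = 9 ℕ.* n ℕ.+ 6
  count = a (9 ℕ.* (k ℕ.∸ j) ℕ.+ 5) (9 ℕ.* k ℕ.+ 1) N
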